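{- If the ElementDistinctness problem can be solved deterministically with space $\widetilde{O}(1)$ and time $\widetilde{O}(n)$, then the SetCollision problem can be solved deterministically with space $\widetilde{O}(1)$ and time $\widetilde{O}(n^{3/2})$. Furthermore, if the algorithm for ElementDistinctness is oblivious, then for every $S\leq n$, there is a deterministic (non-oblivious) algorithm that solves SetCollision with space $\widetilde{O}(S)$ and time $\widetilde{O}\left(\sqrt{n^3/S}\right)$.
   Context: $[n]=\{1,\ldots,n\}$. The notation $\widetilde{O}(\cdot)$ hides factors of $\mathrm{polylog}(n)$, regardless of the content of the parentheses; in particular $\widetilde{O}(1)$ means $O(\mathrm{polylog}(n))$. $D$ is a fixed domain with $|D|=\mathrm{poly}(n)$. **ElementDistinctness.** The input is a list of $n$ elements from $D$. The output is $1$ if all elements are distinct, and $0$ otherwise. **SetCollision.** The input contains two sets $A,B\subseteq D$ given as unordered lists $(a_1,\ldots,a_n)$ and $(b_1,\ldots,b_n)$, each of which contains no duplicated elements in itself. The output consists of all collisions, i.e. all triples $(i,j,x)$ such that $a_i=b_j=x$. **Model of computation.** Algorithms are branching programs. A deterministic branching program on inputs $(x_1,\ldots,x_N)\in D^N$ is a layered directed acyclic graph with a unique initial vertex. Each vertex not in the last layer is labeled with an index $i\in[N]$ and has $|D|$ outgoing edges to the next layer, labeled with the elements of $D$. The computation path on an input starts at the initial vertex, at each vertex labeled $i$ queries $x_i$ and follows the outgoing edge labeled with the value of $x_i$, until reaching the last layer. The program has space $S$ and time $T$ if it has at most $T+1$ layers, each containing at most $2^S$ vertices. It is oblivious if within each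 layer all vertices carry the same index label. For a decision problem, each vertex of the last layer is labeled $0$ or $1$ and the output is the label of the final vertex of the computation path. For a problem whose output is a set, each edge may output arbitrarily many elements, and the final output is the collection of all elements output along the computation path. -}

module Defs where

open import Data.Bool using (Bool; true)
open import Data.Fin using (Fin; zero; _↑ˡ_; _↑ʳ_)
open import Data.List using (List; []; _++_)
open import Data.List.Membership.Propositional using (_∈_)
open import Data.Nat using (ℕ; zero; suc; _+_; _*_; _^_; _≤_)
open import Data.Nat.Logarithm using (⌈log₂_⌉)
open import Data.Product using (Σ; ∃-syntax; _×_; _,_; proj₁; proj₂)
open import Data.Unit using (⊤)
open import Function.Bundles using (_⇔_)
open import Function.Definitions using (Injective)
open import Relation.Binary.PropositionalEquality using (_≡_)

-- The domain D is Fin d, and an input in D^N is a function Fin N → Fin d.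
Input : ℕ → ℕ → Set
Input N d = Fin N → Fin d

-- Layered programs querying inputs in D^N, with data of type E on the edges
-- and of type L on the vertices of the last layer.  Layered N d E L w t
-- consists of t + 1 consecutive layers, the first of which has w vertices.
data Layered (N d : ℕ) (E L : Set) : ℕ → ℕ → Set where
  last  : ∀ {w} → (Fin w → L) → Layered N d E L w 0
  layer : ∀ {w w′ t} →
          (query : Fin w → Fin N) →
          (edge : Fin w → Fin d → Fin w′ × E) →
          Layered N d E L w′ t →
          Layered N d E L w (suc t)

module _ {N d : ℕ} {E L : Set} where

  finalLabel : ∀ {w t} → Layered N d E L w t → Input N d → Fin w → L
  finalLabel (last label) x v = label v
  finalLabel (layer query edge p) x v =
    finalLabel p x (proj₁ (edge v (x (query v))))

  WidthAtMost : ∀ {w t} → ℕ → Layered N d E L w t → Set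
  WidthAtMost {w} m (last _) = w ≤ m
  WidthAtMost {w} m (layer _ _ p) = w ≤ m × WidthAtMost m p

  Oblivious : ∀ {w t} → Layered N d E L w t → Set
  Oblivious (last _) = ⊤
  Oblivious (layer query _ p) = (∀ u v → query u ≡ query v) × Oblivious p

pathOutputs : ∀ {N d O L w t} →
              Layered N d (List O) L w t → Input N d → Fin w → List O
pathOutputs (last _) x v = []
pathOutputs (layer query edge p) x v =
  let (v′ , out) = edge v (x (query v)) in out ++ pathOutputs p x v′

-- A branching program has a unique initial vertex, so its first layer has
-- width 1.

DecisionProgram : (N d T : ℕ) → Set
DecisionProgram N d T = Layered N d ⊤ Bool 1 T

decide : ∀ {N d T} → DecisionProgram N d T → Input N d → Bool
decide p x = finalLabel p x zero

SearchProgram : (N d : ℕ) → Set → (T : ℕ) → Set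
SearchProgram N d O T = Layered N d (List O) ⊤ 1 T

-- Read as a set: order and multiplicity of the outputs are irrelevant.
outputs : ∀ {N d O T} → SearchProgram N d O T → Input N d → List O
outputs p x = pathOutputs p x zero

SolvesElementDistinctness : ∀ {n d T} → DecisionProgram n d T → Set
SolvesElementDistinctness {n} {d} p =
  (x : Input n d) → decide p x ≡ true ⇔ Injective _≡_ _≡_ x

Collision : ℕ → ℕ → Set
Collision n d = Fin n × Fin n × Fin d

-- The input is the concatenation of the two lists; inputs in which one of the
-- lists has a repeated element are outside the promise.
SolvesSetCollision : ∀ {n d T} →
                     SearchProgram (n + n) d (Collision n d) T → Set
SolvesSetCollision {n} {d} p =
  (x : Input (n + n) d) →
  let a = λ (i : Fin n) → x (i ↑ˡ n)
      b = λ (j : Fin n) → x (n ↑ʳ j)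
  in Injective _≡_ _≡_ a → Injective _≡_ _≡_ b →
     ∀ i j v → (i , j , v) ∈ outputs p x ⇔ (a i ≡ b j × b j ≡ v)

-- Solvability for a domain of size d, within space S and time T.

ElementDistinctnessIn : (n d S T : ℕ) → Set
ElementDistinctnessIn n d S T =
  ∃[ t ] t ≤ T × Σ (DecisionProgram n d t) λ p →
    WidthAtMost (2 ^ S) p × SolvesElementDistinctness p

ObliviousElementDistinctnessIn : (n d S T : ℕ) → Set
ObliviousElementDistinctnessIn n d S T =
  ∃[ t ] t ≤ T × Σ (DecisionProgram n d t) λ p →
    WidthAtMost (2 ^ S) p × Oblivious p × SolvesElementDistinctness p

SetCollisionIn : (n d S T : ℕ) → Set
SetCollisionIn n d S T =
  ∃[ t ] t ≤ T × Σ (SearchProgram (n + n) d (Collision n d) t) λ p →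
    WidthAtMost (2 ^ S) p × SolvesSetCollision p

PolyBounded : (ℕ → ℕ) → Set
PolyBounded d = ∃[ c ] (∀ n → d n ≤ n ^ c + c)

-- f = Õ(g) for functions of a parameter a : A; the hidden factors are
-- polylogarithmic in |a|, whatever g is, and the constants are uniform in a.
_∈Õ[_]_ : {A : Set} → (A → ℕ) → (A → ℕ) → (A → ℕ) → Set
f ∈Õ[ ∣_∣ ] g =
  ∃[ c ] ∃[ k ] ∃[ n₀ ]
    (∀ a → n₀ ≤ ∣ a ∣ → f a ≤ c * ⌈log₂ ∣ a ∣ ⌉ ^ k * g a)

-- f = Õ(√(g / h)) for h positive: the inequality f ≤ c logᵏ √(g / h), squared
-- and cleared of its denominator.
_∈Õ√[_]_/_ : {A : Set} → (A → ℕ) → (A → ℕ) → (A → ℕ) → (A → ℕ) → Set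
f ∈Õ√[ ∣_∣ ] g / h =
  ∃[ c ] ∃[ k ] ∃[ n₀ ]
    (∀ a → n₀ ≤ ∣ a ∣ →
      h a * f a ^ 2 ≤ (c * ⌈log₂ ∣ a ∣ ⌉ ^ k) ^ 2 * g a)

record SpaceBudget : Set where
  field
    n S : ℕ
    1≤S : 1 ≤ S
    S≤n : S ≤ n

{-# OPTIONS --safe #-}
module Submission where

-- Cut the second list into blocks of length M ≈ √(nS) and slide a window of the
-- same length over the first list.  A binary search over the window, each of
-- whose rounds keeps the first S intervals that still contain a collision with
-- the block, takes O(log M) rounds of O(S) distinctness tests on 2M elements,
-- in which the elements outside an interval are replaced by fresh dummies.  The
-- copies of an oblivious test read the same positions at the same time, so they
-- all run in the time of one; for S = 1 they can be run one after the other.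
-- Such a pass either finds S of the at most n collisions or moves the window by
-- M, so O(n²/M² + n/S) passes of time Õ(M) suffice.

-- A distinctness test yields a single bit, so collisions have to be located by halving intervals.
-- Keeping only the first S nonempty intervals loses none of the first S collisions, because every
-- kept interval contributes at least one; and since the slots stay in order, the next window can
-- start right behind the last collision found. All copies of the test run on the whole window and
-- the whole block and differ only in which values they replace. This, rather than testing shorter
-- intervals, is what lets the copies of an oblivious program share their queries. With M² ≈ nS both
-- terms of the number of passes are of order n/S, and n/S passes of time √(nS) give √(n³/S). The
-- dummies enlarge the domain while a test has only 2M inputs. As n ≤ M², the enlarged domain is
-- still polynomial in 2M, so the assumed solver is invoked for a polynomially bounded domain other
-- than that of the problem. The resulting program is not oblivious even if the test is, because the
-- position of the window depends on the collisions found so far.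

open import Defs
open import Data.Bool using (Bool; true; false)
open import Data.Empty using (⊥; ⊥-elim)
open import Data.Fin using (Fin; zero; suc; toℕ; fromℕ<; fromℕ; inject₁; inject≤; join; splitAt; combine; remQuot; _↑ˡ_; _↑ʳ_)
open import Data.Fin.Properties using (any?; toℕ<n; toℕ-injective; toℕ-fromℕ<; toℕ-fromℕ; toℕ-inject₁; inject≤-injective; splitAt-↑ˡ; splitAt-↑ʳ; join-splitAt; splitAt-join; remQuot-combine) renaming (_≟_ to _≟ᶠ_)
open import Data.List using (List; []; _∷_; _++_; length; filter; take; concatMap; map; catMaybes)
open import Data.List.Membership.Propositional using (_∈_)
open import Data.List.Membership.Propositional.Properties using (∈-filter⁺; ∈-filter⁻; ∈-map⁺; ∈-map⁻; ∈-++⁻; ∈-++⁺ˡ; ∈-++⁺ʳ)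
open import Data.List.Properties using (filter-++; ++-assoc; ++-identityʳ; length-++; length-filter; length-map; length-take; take-all; take-[])
open import Data.List.Relation.Unary.All using (All; []; _∷_)
open import Data.List.Relation.Unary.All.Properties using () renaming (take⁺ to All-take⁺)
open import Data.List.Relation.Unary.Any using (here; there)
open import Data.Maybe using (Maybe; just; nothing; maybe′; fromMaybe)
open import Data.Nat
open import Data.Nat.DivMod using (_/_; _mod_; m≡m%n+[m/n]*n; m%n<n; m/n*n≤m; m/n≤m; m<n⇒m%n≡m)
open import Data.Nat.Induction using (<-rec)
open import Data.Nat.Logarithm using (⌈log₂_⌉; ⌈log₂⌉-mono-≤; ⌈log₂⌈n/2⌉⌉≡⌈log₂n⌉∸1; ⌈log₂2^n⌉≡n)
open import Data.Nat.Properties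
open import Data.Nat.Tactic.RingSolver using (solve-∀)
open import Data.Product using (Σ; ∃-syntax; _×_; _,_; proj₁; proj₂)
open import Data.Sum using (_⊎_; inj₁; inj₂)
open import Data.Sum.Properties using (inj₁-injective; inj₂-injective)
open import Data.Unit using (⊤)
open import Data.Vec using (Vec; []; _∷_; lookup; tabulate; replicate; head; toList)
open import Data.Vec.Properties using (lookup∘tabulate; lookup-replicate)
open import Function using (id; const; _∘_)
open import Function.Bundles using (_⇔_; mk⇔; Equivalence)
open import Function.Definitions using (Injective)
open import Relation.Binary.PropositionalEquality
open import Relation.Nullary using (¬_; yes; no; _×-dec_)
open import Relation.Unary using (Decidable)
open SpaceBudget using (n; S)

-- Programs with typed states

-- A retraction suffices in place of a bijection: a compiled program enters each layer through
-- `encode`, so vertices outside its image are never reached.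
record Coded (A : Set) (b : ℕ) : Set where
  field
    size : ℕ
    encode : A → Fin size
    decode : Fin size → A
    decode-encode : ∀ a → decode (encode a) ≡ a
    size≤ : size ≤ 2 ^ b

open Coded

coded-Fin : ∀ {n b} → n ≤ 2 ^ b → Coded (Fin n) b
coded-Fin n≤ = record
  { encode = id ; decode = id ; decode-encode = λ _ → refl ; size≤ = n≤ }

coded-Bool : Coded Bool 1
coded-Bool = record
  { size = 2
  ; encode = λ { false → zero ; true → suc zero }
  ; decode = λ { zero → false ; (suc _) → true }
  ; decode-encode = λ { false → refl ; true → refl }
  ; size≤ = ≤-refl
  }

coded-× : ∀ {A B a b} → Coded A a → Coded B b → Coded (A × B) (a + b)
coded-× {a = a} {b} cA cB = record
  { size = size cA * size cB
  ; encode = λ (x , y) → combine (encode cA x) (encode cB y)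
  ; decode = λ v → let (x , y) = remQuot (size cB) v in decode cA x , decode cB y
  ; decode-encode = λ (x , y) → trans
      (cong (λ (u , v) → decode cA u , decode cB v)
            (remQuot-combine (encode cA x) (encode cB y)))
      (cong₂ _,_ (decode-encode cA x) (decode-encode cB y))
  ; size≤ = ≤-trans (*-mono-≤ (size≤ cA) (size≤ cB))
                    (≤-reflexive (sym (^-distribˡ-+-* 2 a b)))
  }

coded-Maybe : ∀ {A b} → Coded A b → Coded (Maybe A) (suc b)
coded-Maybe {b = b} c = record
  { size = suc (size c)
  ; encode = λ { nothing → zero ; (just x) → suc (encode c x) }
  ; decode = λ { zero → nothing ; (suc v) → just (decode c v) }
  ; decode-encode = λ { nothing → refl ; (just x) → cong just (decode-encode c x) }
  ; size≤ = +-mono-≤ (m^n>0 2 b) (≤-trans (size≤ c) (m≤m+n _ 0))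
  }

coded-Vec : ∀ {A b} k → Coded A b → Coded (Vec A k) (k * b)
coded-Vec zero c = record
  { size = 1 ; encode = λ _ → zero ; decode = λ _ → []
  ; decode-encode = λ { [] → refl } ; size≤ = ≤-refl }
coded-Vec {A} {b} (suc k) c = record
  { size = size cs
  ; encode = λ { (x ∷ xs) → encode cs (x , xs) }
  ; decode = λ v → let (x , xs) = decode cs v in x ∷ xs
  ; decode-encode = λ { (x ∷ xs) → cong (λ (y , ys) → y ∷ ys) (decode-encode cs (x , xs)) }
  ; size≤ = size≤ cs
  }
  where
  cs : Coded (A × Vec A k) (b + k * b)
  cs = coded-× c (coded-Vec k c)

coded-≤ : ∀ {A a b} → a ≤ b → Coded A a → Coded A b
coded-≤ a≤b c = record
  { Coded c hiding (size≤) ; size≤ = ≤-trans (size≤ c) (^-monoʳ-≤ 2 a≤b) }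

-- Straight-line programs whose intermediate states are arbitrary types with a
-- code of S bits; only the states from which an input is read are vertices.
data Prog (N d : ℕ) (O : Set) (S : ℕ) (B : Set) : Set → ℕ → Set₁ where
  ret  : ∀ {A} → (A → B) → Prog N d O S B A 0
  read : ∀ {A A′ C t} → Coded A′ S → (A → A′) → (A′ → Fin N) →
         (A′ → Fin d → C × List O) → Prog N d O S B C t → Prog N d O S B A (suc t)

module _ {N d : ℕ} {O : Set} {S : ℕ} where

  result : ∀ {A B t} → Prog N d O S B A t → Input N d → A → B
  result (ret f) x a = f a
  result (read c f q e p) x a = result p x (proj₁ (e (f a) (x (q (f a)))))

  emitted : ∀ {A B t} → Prog N d O S B A t → Input N d → A → List O
  emitted (ret f) x a = []
  emitted (read c f q e p) x a =
    let (c , out) = e (f a) (x (q (f a))) in out ++ emitted p x c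

  premap : ∀ {A A′ B t} → (A′ → A) → Prog N d O S B A t → Prog N d O S B A′ t
  premap g (ret f) = ret (f ∘ g)
  premap g (read c f q e p) = read c (f ∘ g) q e p

  postmap : ∀ {A B B′ t} → (B → B′) → Prog N d O S B A t → Prog N d O S B′ A t
  postmap g (ret f) = ret (g ∘ f)
  postmap g (read c f q e p) = read c f q e (postmap g p)

  infixr 5 _⨾_
  _⨾_ : ∀ {A B C t t′} → Prog N d O S B A t → Prog N d O S C B t′ →
        Prog N d O S C A (t + t′)
  ret f ⨾ r = premap f r
  read c f q e p ⨾ r = read c f q e (p ⨾ r)

  result-premap : ∀ {A A′ B t} (g : A′ → A) (p : Prog N d O S B A t) x a →
                  result (premap g p) x a ≡ result p x (g a)
  result-premap g (ret f) x a = refl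
  result-premap g (read c f q e p) x a = refl

  emitted-premap : ∀ {A A′ B t} (g : A′ → A) (p : Prog N d O S B A t) x a →
                   emitted (premap g p) x a ≡ emitted p x (g a)
  emitted-premap g (ret f) x a = refl
  emitted-premap g (read c f q e p) x a = refl

  result-postmap : ∀ {A B B′ t} (g : B → B′) (p : Prog N d O S B A t) x a →
                   result (postmap g p) x a ≡ g (result p x a)
  result-postmap g (ret f) x a = refl
  result-postmap g (read c f q e p) x a = result-postmap g p x _

  emitted-postmap : ∀ {A B B′ t} (g : B → B′) (p : Prog N d O S B A t) x a →
                    emitted (postmap g p) x a ≡ emitted p x a
  emitted-postmap g (ret f) x a = refl
  emitted-postmap g (read c f q e p) x a = cong (_ ++_) (emitted-postmap g p x _)

  result-⨾ : ∀ {A B C t t′} (p : Prog N d O S B A t) (r : Prog N d O S C B t′) x a →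
             result (p ⨾ r) x a ≡ result r x (result p x a)
  result-⨾ (ret f) r x a = result-premap f r x a
  result-⨾ (read c f q e p) r x a = result-⨾ p r x _

  emitted-⨾ : ∀ {A B C t t′} (p : Prog N d O S B A t) (r : Prog N d O S C B t′) x a →
              emitted (p ⨾ r) x a ≡ emitted p x a ++ emitted r x (result p x a)
  emitted-⨾ (ret f) r x a = emitted-premap f r x a
  emitted-⨾ (read c f q e p) r x a =
    trans (cong (_ ++_) (emitted-⨾ p r x _)) (sym (++-assoc (proj₂ (e _ _)) _ _))

  repeat : ∀ {A t} k → Prog N d O S A A t → Prog N d O S A A (k * t)
  repeat zero p = ret id
  repeat (suc k) p = p ⨾ repeat k p

  -- Each value read is moved into the frame `F`, whose code grows by `δ` bits while `k` drops by
  -- one. The budget `b + k * δ` is therefore constant along the recursion.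
  gather : ∀ {F b δ} k → Coded F b → Coded (Fin d) δ → b + k * δ ≤ S →
           (F → Fin k → Fin N) → Prog N d O S (F × Vec (Fin d) k) F k
  gather zero c cd fits loc = ret (λ f → f , [])
  gather {b = b} {δ} (suc k) c cd fits loc =
    read (coded-≤ (m+n≤o⇒m≤o b fits) c) id (λ f → loc f zero) (λ f v → (f , v) , [])
      (postmap (λ ((f , v) , vs) → f , v ∷ vs)
        (gather k (coded-× c cd) cd (subst (_≤ S) (sym (+-assoc b δ (k * δ))) fits)
                (λ (f , _) j → loc f (suc j))))

  result-gather : ∀ {F b δ} k (c : Coded F b) (cd : Coded (Fin d) δ) fits
                  (loc : F → Fin k → Fin N) x f →
                  result (gather k c cd fits loc) x f ≡ (f , tabulate (x ∘ loc f))
  result-gather zero c cd fits loc x f = refl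
  result-gather {b = b} {δ} (suc k) c cd fits loc x f =
    trans (result-postmap _ (gather k (coded-× c cd) cd _ (λ (f , _) j → loc f (suc j))) x _)
          (cong (λ ((f , v) , vs) → f , v ∷ vs)
                (result-gather k (coded-× c cd) cd _ (λ (f , _) j → loc f (suc j)) x _))

  emitted-gather : ∀ {F b δ} k (c : Coded F b) (cd : Coded (Fin d) δ) fits
                   (loc : F → Fin k → Fin N) x f →
                   emitted (gather k c cd fits loc) x f ≡ []
  emitted-gather zero c cd fits loc x f = refl
  emitted-gather (suc k) c cd fits loc x f =
    trans (emitted-postmap _ (gather k (coded-× c cd) cd _ _) x _)
          (emitted-gather k (coded-× c cd) cd _ _ x _)

  scan : ∀ {F} k → Coded F S → (F → Fin k → Fin N) → (F → Fin k → Fin d → List O) →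
         Prog N d O S F F k
  scan zero c loc out = ret id
  scan (suc k) c loc out =
    read c id (λ f → loc f zero) (λ f v → f , out f zero v)
      (scan k c (λ f → loc f ∘ suc) (λ f → out f ∘ suc))

  result-scan : ∀ {F} k (c : Coded F S) loc out x f →
                result (scan k c loc out) x f ≡ f
  result-scan zero c loc out x f = refl
  result-scan (suc k) c loc out x f = result-scan k c _ _ x f

  ∈-emitted-scan : ∀ {F} k (c : Coded F S) (loc : F → Fin k → Fin N) out x f {o} →
                   o ∈ emitted (scan k c loc out) x f ⇔
                   (∃[ j ] o ∈ out f j (x (loc f j)))
  ∈-emitted-scan zero c loc out x f = mk⇔ (λ ()) (λ ())
  ∈-emitted-scan (suc k) c loc out x f {o} = mk⇔ to from
    where
    module IH = Equivalence (∈-emitted-scan k c (λ f → loc f ∘ suc) (λ f → out f ∘ suc) x f {o})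
    to : o ∈ emitted (scan (suc k) c loc out) x f → ∃[ j ] o ∈ out f j (x (loc f j))
    to o∈ with ∈-++⁻ (out f zero (x (loc f zero))) o∈
    ... | inj₁ h = zero , h
    ... | inj₂ t = let (j , h) = IH.to t in suc j , h
    from : (∃[ j ] o ∈ out f j (x (loc f j))) → o ∈ emitted (scan (suc k) c loc out) x f
    from (zero , h) = ∈-++⁺ˡ h
    from (suc j , h) = ∈-++⁺ʳ (out f zero (x (loc f zero))) (IH.from (j , h))

  record Compiled (A : Set) (t : ℕ) : Set where
    field
      {width} : ℕ
      start : A → Fin width
      body : Layered N d (List O) ⊤ width t

  open Compiled

  compile : ∀ {A B t} → Prog N d O S B A t → Compiled A t
  compile (ret f) = record { width = 1 ; start = λ _ → zero ; body = last _ }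
  compile (read c f q e p) = record
    { start = encode c ∘ f
    ; body = layer (q ∘ decode c)
        (λ v y → let (s , out) = e (decode c v) y in start (compile p) s , out)
        (body (compile p))
    }

  compile-width : ∀ {A B t} (p : Prog N d O S B A t) →
                  WidthAtMost (2 ^ S) (body (compile p))
  compile-width (ret f) = m^n>0 2 S
  compile-width (read c f q e p) = size≤ c , compile-width p

  compile-outputs : ∀ {A B t} (p : Prog N d O S B A t) x a →
    pathOutputs (body (compile p)) x (start (compile p) a) ≡ emitted p x a
  compile-outputs (ret f) x a = refl
  compile-outputs (read c f q e p) x a rewrite decode-encode c (f a) =
    cong (_ ++_) (compile-outputs p x _)

  -- A search program must start in a layer of width 1. Renaming the vertices of the first layer
  -- along a constant map hard-wires the initial state without spending a query.
  reindex : ∀ {E L : Set} {w w′ t} → (Fin w′ → Fin w) → Layered N d E L w t →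
            Layered N d E L w′ t
  reindex g (last l) = last (l ∘ g)
  reindex g (layer q e p) = layer (q ∘ g) (e ∘ g) p

  reindex-width : ∀ {E L : Set} {w w′ t m} (g : Fin w′ → Fin w) (p : Layered N d E L w t) →
                  w′ ≤ m → WidthAtMost m p → WidthAtMost m (reindex g p)
  reindex-width g (last l) w′≤m _ = w′≤m
  reindex-width g (layer q e p) w′≤m (_ , bounded) = w′≤m , bounded

  reindex-outputs : ∀ {L : Set} {w w′ t} (g : Fin w′ → Fin w) (p : Layered N d (List O) L w t) x v →
                    pathOutputs (reindex g p) x v ≡ pathOutputs p x (g v)
  reindex-outputs g (last l) x v = refl
  reindex-outputs g (layer q e p) x v = refl

  toSearchProgram : ∀ {A B t} → Prog N d O S B A t → A →
    Σ (SearchProgram N d O t) λ r → WidthAtMost (2 ^ S) r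
  toSearchProgram p a =
    reindex (λ _ → start (compile p) a) (body (compile p)) ,
    reindex-width _ (body (compile p)) (m^n>0 2 S) (compile-width p)

  outputs-toSearchProgram : ∀ {A B t} (p : Prog N d O S B A t) a x →
    outputs (proj₁ (toSearchProgram p a)) x ≡ emitted p x a
  outputs-toSearchProgram p a x =
    trans (reindex-outputs _ (body (compile p)) x zero) (compile-outputs p x a)

-- Running several copies of a distinctness test

-- A Tester runs κ copies of a decision program; the k-th copy sees, at its
-- position r, the value val f k r v computed from the value v read at loc f r.
record Tester {N′ d′ T : ℕ} (p : DecisionProgram N′ d′ T) (N d : ℕ) (O : Set)
              (κ τ ω : ℕ) : Set₁ where
  field
    test : ∀ {S F b} → Coded F b → b + ω ≤ S → (F → Fin N′ → Fin N) →
           (F → Fin κ → Fin N′ → Fin d → Fin d′) →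
           Prog N d O S (F × Vec Bool κ) F τ
    emitted-test : ∀ {S F b} (c : Coded F b) (fits : b + ω ≤ S) loc val x f →
                   emitted (test c fits loc val) x f ≡ []
    result-test : ∀ {S F b} (c : Coded F b) (fits : b + ω ≤ S) loc val x f →
                  Σ (Vec Bool κ) λ bs → result (test c fits loc val) x f ≡ (f , bs) ×
                    (∀ k → lookup bs k ≡ decide p (λ r → val f k r (x (loc f r))))

module _ {N′ d′ N d : ℕ} {O : Set} where

  module Simulation {S F b ω} (c : Coded F b) (fits : b + ω ≤ S)
                    (loc : F → Fin N′ → Fin N) where

    module _ (val : F → Fin N′ → Fin d → Fin d′) where

      simulate : ∀ {w t} (p : Layered N′ d′ ⊤ Bool w t) → WidthAtMost (2 ^ ω) p →
                 Prog N d O S (F × Bool) (F × Fin w) t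
      simulate (last l) _ = ret (λ (f , v) → f , l v)
      simulate (layer q e p) (w≤ , bounded) =
        read (coded-≤ fits (coded-× c (coded-Fin w≤))) id (λ (f , v) → loc f (q v))
          (λ (f , v) y → (f , proj₁ (e v (val f (q v) y))) , [])
          (simulate p bounded)

      result-simulate : ∀ {w t} (p : Layered N′ d′ ⊤ Bool w t) bounded x f v →
        result (simulate p bounded) x (f , v) ≡
        (f , finalLabel p (λ r → val f r (x (loc f r))) v)
      result-simulate (last l) _ x f v = refl
      result-simulate (layer q e p) (_ , bounded) x f v = result-simulate p bounded x f _

      emitted-simulate : ∀ {w t} (p : Layered N′ d′ ⊤ Bool w t) bounded x f v →
        emitted (simulate p bounded) x (f , v) ≡ []
      emitted-simulate (last l) _ x f v = refl
      emitted-simulate (layer q e p) (_ , bounded) x f v = emitted-simulate p bounded x f _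

  -- All copies of an oblivious program query the same position at the same
  -- time, so one query serves them all.
  module Parallel {S F b ω} (c : Coded F b) {κ : ℕ}
                  (fits : b + suc κ * ω ≤ S) (loc : F → Fin N′ → Fin N)
                  (val : F → Fin (suc κ) → Fin N′ → Fin d → Fin d′) where

    parallel : ∀ {w t} (p : Layered N′ d′ ⊤ Bool w t) → WidthAtMost (2 ^ ω) p →
               Prog N d O S (F × Vec Bool (suc κ)) (F × Vec (Fin w) (suc κ)) t
    parallel (last l) _ = ret (λ (f , vs) → f , tabulate (l ∘ lookup vs))
    parallel (layer q e p) (w≤ , bounded) =
      read (coded-≤ fits (coded-× c (coded-Vec (suc κ) (coded-Fin w≤)))) id
        (λ (f , vs) → loc f (q (head vs)))
        (λ (f , vs) y → (f , tabulate λ k →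
          proj₁ (e (lookup vs k) (val f k (q (head vs)) y))) , [])
        (parallel p bounded)

    -- The query is chosen by the vertex of the first copy, which exists because there are `suc κ`
    -- of them. Obliviousness enters as `same`: every other copy would have queried the same
    -- position from its own vertex.
    result-parallel : ∀ {w t} (p : Layered N′ d′ ⊤ Bool w t) bounded → Oblivious p →
      ∀ x f vs → Σ (Vec Bool (suc κ)) λ bs →
        result (parallel p bounded) x (f , vs) ≡ (f , bs) ×
        (∀ k → lookup bs k ≡ finalLabel p (λ r → val f k r (x (loc f r))) (lookup vs k))
    result-parallel (last l) _ _ x f vs =
      _ , refl , λ k → lookup∘tabulate (l ∘ lookup vs) k
    result-parallel (layer q e p) (_ , bounded) (same , obl) x f vs =
      let us = tabulate λ k →
                 proj₁ (e (lookup vs k) (val f k (q (head vs)) (x (loc f (q (head vs))))))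
          (bs , eq , labels) = result-parallel p bounded obl x f us
      in bs , eq , λ k → trans (labels k) (cong (finalLabel p _) (trans
           (lookup∘tabulate
             (λ k → proj₁ (e (lookup vs k) (val f k (q (head vs)) (x (loc f (q (head vs)))))))
             k)
           (cong (λ r → proj₁ (e (lookup vs k) (val f k r (x (loc f r)))))
                 (same (head vs) (lookup vs k)))))

    emitted-parallel : ∀ {w t} (p : Layered N′ d′ ⊤ Bool w t) bounded x f vs →
      emitted (parallel p bounded) x (f , vs) ≡ []
    emitted-parallel (last l) _ x f vs = refl
    emitted-parallel (layer q e p) (_ , bounded) x f vs = emitted-parallel p bounded x f _

  obliviousTester : ∀ {T ω} κ (p : DecisionProgram N′ d′ T) → WidthAtMost (2 ^ ω) p →
                    Oblivious p → Tester p N d O (suc κ) T (suc κ * ω)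
  obliviousTester {ω = ω} κ p bounded obl = record
    { test = λ c fits loc val →
        premap (λ f → f , replicate _ zero) (Parallel.parallel {ω = ω} c fits loc val p bounded)
    ; emitted-test = λ c fits loc val x f →
        trans (emitted-premap _ (Parallel.parallel {ω = ω} c fits loc val p bounded) x f)
              (Parallel.emitted-parallel {ω = ω} c fits loc val p bounded x f _)
    ; result-test = λ c fits loc val x f →
        let (bs , eq , labels) =
              Parallel.result-parallel {ω = ω} c fits loc val p bounded obl x f (replicate _ zero)
        in bs ,
           trans (result-premap _ (Parallel.parallel {ω = ω} c fits loc val p bounded) x f) eq ,
           λ k → trans (labels k) (cong (finalLabel p _) (lookup-replicate k zero))
    }

  -- The answers join the frame one bit at a time while the number of remaining copies drops, so `κ`
  -- bits for answers and `ω` for the vertex of the running copy suffice throughout.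
  sequentialTester : ∀ {T ω} κ (p : DecisionProgram N′ d′ T) → WidthAtMost (2 ^ ω) p →
                     Tester p N d O κ (κ * T) (κ + ω)
  sequentialTester {T} {ω} κ₀ p bounded = record
    { test = go κ₀ ; emitted-test = emitted-go κ₀ ; result-test = result-go κ₀ }
    where
    once : ∀ {S F b κ} → Coded F b → b + (suc κ + ω) ≤ S → (F → Fin N′ → Fin N) →
           (F → Fin N′ → Fin d → Fin d′) → Prog N d O S (F × Bool) F T
    once {b = b} {κ} c fits loc val = premap (_, zero)
      (Simulation.simulate c (≤-trans (+-monoʳ-≤ b (m≤n+m ω (suc κ))) fits) loc val p bounded)

    rest-fits : ∀ {S} b κ → b + (suc κ + ω) ≤ S → (b + 1) + (κ + ω) ≤ S
    rest-fits {S} b κ = subst (_≤ S) (sym (+-assoc b 1 (κ + ω)))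

    go : ∀ κ {S F b} → Coded F b → b + (κ + ω) ≤ S → (F → Fin N′ → Fin N) →
         (F → Fin κ → Fin N′ → Fin d → Fin d′) → Prog N d O S (F × Vec Bool κ) F (κ * T)
    go zero c fits loc val = ret (λ f → f , [])
    go (suc κ) {b = b} c fits loc val =
      once {κ = κ} c fits loc (λ f → val f zero) ⨾
      postmap (λ ((f , l) , ls) → f , l ∷ ls)
        (go κ (coded-× c coded-Bool) (rest-fits b κ fits) (loc ∘ proj₁)
            (λ (f , _) → val f ∘ suc))

    result-once : ∀ {S F b κ} (c : Coded F b) (fits : b + (suc κ + ω) ≤ S) loc val x f →
                  result (once {κ = κ} c fits loc val) x f ≡
                  (f , decide p (λ r → val f r (x (loc f r))))
    result-once c fits loc val x f =
      trans (result-premap (_, zero) (Simulation.simulate c _ loc val p bounded) x f)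
            (Simulation.result-simulate c _ loc val p bounded x f zero)

    emitted-go : ∀ κ {S F b} (c : Coded F b) (fits : b + (κ + ω) ≤ S) loc val x f →
                 emitted (go κ c fits loc val) x f ≡ []
    emitted-go zero c fits loc val x f = refl
    emitted-go (suc κ) {b = b} c fits loc val x f =
      trans (emitted-⨾ (once {κ = κ} c fits loc (λ f → val f zero)) _ x f)
        (cong₂ _++_
          (trans (emitted-premap (_, zero) (Simulation.simulate c _ loc _ p bounded) x f)
                 (Simulation.emitted-simulate c _ loc _ p bounded x f zero))
          (trans (emitted-postmap _ (go κ _ (rest-fits b κ fits) _ _) x _)
                 (emitted-go κ _ (rest-fits b κ fits) _ _ x _)))

    result-go : ∀ κ {S F b} (c : Coded F b) (fits : b + (κ + ω) ≤ S) loc val x f →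
                Σ (Vec Bool κ) λ bs → result (go κ c fits loc val) x f ≡ (f , bs) ×
                  (∀ k → lookup bs k ≡ decide p (λ r → val f k r (x (loc f r))))
    result-go zero c fits loc val x f = [] , refl , λ ()
    result-go (suc κ) {b = b} c fits loc val x f =
      let l = decide p (λ r → val f zero r (x (loc f r)))
          (ls , eq , labels) =
            result-go κ (coded-× c coded-Bool) (rest-fits b κ fits) (loc ∘ proj₁)
              (λ (f , _) → val f ∘ suc) x (f , l)
      in l ∷ ls ,
         trans (result-⨾ (once {κ = κ} c fits loc (λ f → val f zero)) _ x f)
          (trans (result-postmap _ (go κ _ (rest-fits b κ fits) _ _) x _)
            (cong (λ ((f , l) , ls) → f , l ∷ ls)
              (trans (cong (result (go κ _ (rest-fits b κ fits) _ _) x)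
                       (result-once {κ = κ} c fits loc (λ f → val f zero) x f)) eq))) ,
         λ { zero → refl ; (suc k) → labels k }

-- Lists of collisions and slots

range : ℕ → ℕ → List ℕ
range s zero = []
range s (suc l) = s ∷ range (suc s) l

range-++ : ∀ s k l → range s (k + l) ≡ range s k ++ range (s + k) l
range-++ s zero l = cong (λ r → range r l) (sym (+-identityʳ s))
range-++ s (suc k) l = cong (s ∷_)
  (trans (range-++ (suc s) k l) (cong (λ r → range (suc s) k ++ range r l) (sym (+-suc s k))))

∈-range⁺ : ∀ {s i} l → s ≤ i → i < s + l → i ∈ range s l
∈-range⁺ {s} {i} zero s≤i i< = ⊥-elim (<⇒≱ i< (subst (_≤ i) (sym (+-identityʳ s)) s≤i))
∈-range⁺ {s} {i} (suc l) s≤i i< with s ≟ i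
... | yes refl = here refl
... | no s≢i = there (∈-range⁺ l (≤∧≢⇒< s≤i s≢i) (subst (i <_) (+-suc s l) i<))

∈-range⁻ : ∀ {s i} l → i ∈ range s l → s ≤ i × i < s + l
∈-range⁻ {s} (suc l) (here refl) = ≤-refl , m<m+n s z<s
∈-range⁻ {s} {i} (suc l) (there i∈) =
  let (s< , i<) = ∈-range⁻ l i∈ in <⇒≤ s< , subst (i <_) (sym (+-suc s l)) i<

length-range : ∀ s l → length (range s l) ≡ l
length-range s zero = refl
length-range s (suc l) = cong suc (length-range (suc s) l)

-- One past the last entry of the list, or `s` if there is none: the place from which a search
-- continues.
advance : ℕ → List ℕ → ℕ
advance s [] = s
advance s (x ∷ xs) = advance (suc x) xs

advance-nonempty : ∀ {s s′} xs → 0 < length xs → advance s xs ≡ advance s′ xs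
advance-nonempty (x ∷ xs) _ = refl

module _ {P : ℕ → Set} (P? : Decidable P) where

  filter-range-resume : ∀ k s l → let xs = take k (filter P? (range s l)) in
    k ≤ length xs → ∃[ l′ ] l′ ≤ l × advance s xs + l′ ≡ s + l ×
      filter P? (range s l) ≡ xs ++ filter P? (range (advance s xs) l′)
  filter-range-resume zero s l _ = l , ≤-refl , refl , refl
  filter-range-resume (suc k) s (suc l) k≤ with P? s
  ... | yes _ =
    let (l′ , l′≤ , sum , eq) = filter-range-resume k (suc s) l (s≤s⁻¹ k≤)
    in l′ , m≤n⇒m≤1+n l′≤ , trans sum (sym (+-suc s l)) , cong (s ∷_) eq
  -- At least one match is still to come, so `advance` does not depend on its starting value, and
  -- `s` may be exchanged for `suc s`.
  ... | no _
    with filter-range-resume (suc k) (suc s) l k≤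
       | advance-nonempty {s} {suc s} (take (suc k) (filter P? (range (suc s) l)))
                          (≤-trans z<s k≤)
  ... | l′ , l′≤ , sum , eq | adv rewrite adv =
    l′ , m≤n⇒m≤1+n l′≤ , trans sum (sym (+-suc s l)) , eq

filter-singleton : ∀ {A : Set} {P : A → Set} (P? : Decidable P) {x} →
  0 < length (filter P? (x ∷ [])) → filter P? (x ∷ []) ≡ x ∷ []
filter-singleton P? {x} nonempty with P? x
... | yes _ = refl
filter-singleton P? {x} () | no _

filter-cong-∈ : ∀ {A : Set} {P Q : A → Set} (P? : Decidable P) (Q? : Decidable Q) xs →
  (∀ {x} → x ∈ xs → P x → Q x) → (∀ {x} → x ∈ xs → Q x → P x) → filter P? xs ≡ filter Q? xs
filter-cong-∈ P? Q? [] to from = refl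
filter-cong-∈ P? Q? (x ∷ xs) to from
  with P? x | Q? x | filter-cong-∈ P? Q? xs (to ∘ there) (from ∘ there)
... | yes _ | yes _ | eq = cong (x ∷_) eq
... | no _  | no _  | eq = eq
... | yes p | no ¬q | _  = ⊥-elim (¬q (to (here refl) p))
... | no ¬p | yes q | _  = ⊥-elim (¬p (from (here refl) q))

length-filter-disjoint : ∀ {A : Set} {P Q U : A → Set}
  (P? : Decidable P) (Q? : Decidable Q) (U? : Decidable U) →
  (∀ {x} → P x → ¬ Q x) → (∀ {x} → P x → U x) → (∀ {x} → Q x → U x) →
  ∀ xs → length (filter P? xs) + length (filter Q? xs) ≤ length (filter U? xs)
length-filter-disjoint P? Q? U? P⇒¬Q P⇒U Q⇒U [] = z≤n
length-filter-disjoint P? Q? U? P⇒¬Q P⇒U Q⇒U (x ∷ xs)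
  with P? x | Q? x | U? x | length-filter-disjoint P? Q? U? P⇒¬Q P⇒U Q⇒U xs
... | yes p | yes q | _     | _  = ⊥-elim (P⇒¬Q p q)
... | yes p | no _  | no ¬u | _  = ⊥-elim (¬u (P⇒U p))
... | no _  | yes q | no ¬u | _  = ⊥-elim (¬u (Q⇒U q))
... | yes _ | no _  | yes _ | le = s≤s le
... | no _  | yes _ | yes _ | le = ≤-trans (≤-reflexive (+-suc (length (filter P? xs)) _)) (s≤s le)
... | no _  | no _  | yes _ | le = m≤n⇒m≤1+n le
... | no _  | no _  | no _  | le = le

take-++-cong : ∀ {A : Set} {k} {ys ys′ : List A} → (∀ {j} → j ≤ k → take j ys ≡ take j ys′) →
               ∀ xs {j} → j ≤ k → take j (xs ++ ys) ≡ take j (xs ++ ys′)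
take-++-cong eq [] j≤ = eq j≤
take-++-cong eq (x ∷ xs) {zero} j≤ = refl
take-++-cong eq (x ∷ xs) {suc j} j≤ = cong (x ∷_) (take-++-cong eq xs (<⇒≤ j≤))

module _ {A : Set} where

  pad : ∀ k → List A → Vec (Maybe A) k
  pad zero _ = []
  pad (suc k) [] = nothing ∷ pad k []
  pad (suc k) (x ∷ xs) = just x ∷ pad k xs

  live : ∀ {k} → Vec (Maybe A) k → List A
  live = catMaybes ∘ toList

  live-pad : ∀ k xs → live (pad k xs) ≡ take k xs
  live-pad zero xs = refl
  live-pad (suc k) (x ∷ xs) = cong (x ∷_) (live-pad k xs)
  live-pad (suc zero) [] = refl
  live-pad (suc (suc k)) [] = live-pad (suc k) []

  length-live : ∀ {k} (xs : Vec (Maybe A) k) → length (live xs) ≤ k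
  length-live [] = z≤n
  length-live (just x ∷ xs) = s≤s (length-live xs)
  length-live (nothing ∷ xs) = m≤n⇒m≤1+n (length-live xs)

  -- A bit `true` says that the test found all elements distinct, hence that the interval in the
  -- slot holds no collision.
  discard : ∀ {k} → Vec (Maybe A) k → Vec Bool k → List A
  discard [] [] = []
  discard (just x ∷ xs) (false ∷ bs) = x ∷ discard xs bs
  discard (just x ∷ xs) (true ∷ bs) = discard xs bs
  discard (nothing ∷ xs) (b ∷ bs) = discard xs bs

  -- A slot stores only the start of an interval, its length being fixed by the round. The left half
  -- thus keeps the entry itself.
  children : ∀ {k} → (A → Maybe A) → Vec (Maybe A) k → Vec (Maybe A) (k * 2)
  children right [] = []
  children right (nothing ∷ xs) = nothing ∷ nothing ∷ children right xs
  children right (just x ∷ xs) = just x ∷ right x ∷ children right xs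

  module _ {B : Set} (f : A → List B) where

    concatMap-children : ∀ {f′ : A → List B} right → (∀ x → f′ x ≡ f x ++ maybe′ f [] (right x)) →
      ∀ {k} (xs : Vec (Maybe A) k) → concatMap f (live (children right xs)) ≡ concatMap f′ (live xs)
    concatMap-children right split [] = refl
    concatMap-children right split (nothing ∷ xs) = concatMap-children right split xs
    concatMap-children {f′} right split (just x ∷ xs)
      with right x | split x | concatMap-children right split xs
    ... | just y  | eq | IH =
      trans (cong (λ zs → f x ++ f y ++ zs) IH)
            (trans (sym (++-assoc (f x) (f y) _)) (cong (_++ concatMap f′ (live xs)) (sym eq)))
    ... | nothing | eq | IH =
      cong₂ _++_ (sym (trans eq (++-identityʳ (f x)))) IH

    concatMap-discard : ∀ {k} (xs : Vec (Maybe A) k) bs →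
      (∀ {i x} → lookup xs i ≡ just x → lookup bs i ≡ true → f x ≡ []) →
      concatMap f (discard xs bs) ≡ concatMap f (live xs)
    concatMap-discard [] [] _ = refl
    concatMap-discard (just x ∷ xs) (false ∷ bs) empty =
      cong (f x ++_) (concatMap-discard xs bs (λ {i} → empty {suc i}))
    concatMap-discard (just x ∷ xs) (true ∷ bs) empty
      rewrite empty {zero} refl refl = concatMap-discard xs bs (λ {i} → empty {suc i})
    concatMap-discard (nothing ∷ xs) (b ∷ bs) empty =
      concatMap-discard xs bs (λ {i} → empty {suc i})

    -- The first `k` lists are nonempty and so already supply `k` entries, if there are that many
    -- lists. The first entry of each list pays for the decrease of `k` and `j`; the rest of that
    -- list is passed over by `take-++-cong`.
    take-concatMap-take : ∀ k {j xs} → All (λ x → 0 < length (f x)) xs → j ≤ k →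
      take j (concatMap f (take k xs)) ≡ take j (concatMap f xs)
    take-concatMap-take zero [] z≤n = refl
    take-concatMap-take zero (_ ∷ _) z≤n = refl
    take-concatMap-take (suc k) [] _ = refl
    take-concatMap-take (suc k) {zero} (_ ∷ _) _ = refl
    take-concatMap-take (suc k) {suc j} {x ∷ xs} (0< ∷ all) (s≤s j≤k) with f x
    take-concatMap-take (suc k) {suc j} {x ∷ xs} (() ∷ all) (s≤s j≤k) | []
    ... | y ∷ ys = cong (y ∷_) (take-++-cong (take-concatMap-take k all) ys j≤k)

  All-discard : ∀ {Q : A → Set} {k} (xs : Vec (Maybe A) k) bs →
    (∀ {i x} → lookup xs i ≡ just x → lookup bs i ≡ false → Q x) → All Q (discard xs bs)
  All-discard [] [] _ = []
  All-discard (just x ∷ xs) (false ∷ bs) q = q {zero} refl refl ∷ All-discard xs bs (λ {i} → q {suc i})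
  All-discard (just x ∷ xs) (true ∷ bs) q = All-discard xs bs (λ {i} → q {suc i})
  All-discard (nothing ∷ xs) (b ∷ bs) q = All-discard xs bs (λ {i} → q {suc i})

-- The order in which collisions are found

module _ {n : ℕ} .{{_ : NonZero n}} where

  -- Makes index arithmetic total. The wrap-around has no effect on results: values read at
  -- positions from `n` on are hidden from the tests and skipped by the report.
  clamp : ℕ → Fin n
  clamp i = i mod n

  toℕ-clamp : ∀ {i} → i < n → toℕ (clamp i) ≡ i
  toℕ-clamp {i} i<n = trans (toℕ-fromℕ< (m%n<n i n)) (m<n⇒m%n≡m i<n)

  clamp-toℕ : ∀ i → clamp (toℕ i) ≡ i
  clamp-toℕ i = toℕ-injective (toℕ-clamp (toℕ<n i))

-- found: the first K matches in the window of length M from s.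
resume : (M K s : ℕ) → List ℕ → ℕ
resume M K s found with K ≤? length found
... | yes _ = advance s found
... | no _ = s + M

-- The row and the start of the next window, if the window from row J resumes at s′.
data Next (n J s′ : ℕ) : ℕ → ℕ → Set where
  stay : s′ < n → Next n J s′ (suc J) s′
  down : n ≤ s′ → Next n J s′ J 0

module Sweep {n d : ℕ} .{{_ : NonZero n}} (M K : ℕ) (a b : Fin n → Fin d) where

  Match : ℕ → ℕ → ℕ → Set
  Match lo hi i = i < n × ∃[ j ] lo ≤ toℕ j × toℕ j < hi × a (clamp i) ≡ b j

  match? : ∀ lo hi → Decidable (Match lo hi)
  match? lo hi i = (i <? n) ×-dec any? λ j →
    (lo ≤? toℕ j) ×-dec (toℕ j <? hi) ×-dec (a (clamp i) ≟ᶠ b j)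

  -- `J` counts the blocks still to be swept, including the current one. Blocks are taken from the
  -- last to the first, so the current one has number `J - 1` counted from 0, and `J = 0` means that
  -- the sweep is over.
  offset : ℕ → ℕ
  offset J = pred J * M

  row? : ∀ J → Decidable (Match (offset J) (M + offset J))
  row? J = match? (offset J) (M + offset J)

  -- A row is swept up to M + n, so that its last window has full length.
  matches-+-≤ : Injective _≡_ _≡_ b → ∀ J xs →
    length (filter (row? (suc J)) xs) + length (filter (match? 0 (J * M)) xs) ≤
    length (filter (match? 0 (M + J * M)) xs)
  matches-+-≤ b-inj J = length-filter-disjoint (row? (suc J)) (match? 0 (J * M)) (match? 0 (M + J * M))
    (λ (_ , j , lo , _ , eq) (_ , j′ , _ , hi , eq′) →
      <⇒≱ hi (subst (λ j → J * M ≤ toℕ j) (b-inj (trans (sym eq) eq′)) lo))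
    (λ (i<n , j , _ , hi , eq) → i<n , j , z≤n , hi , eq)
    (λ (i<n , j , _ , hi , eq) → i<n , j , z≤n , ≤-trans hi (m≤n+m (J * M) M) , eq)

  left : ℕ → ℕ
  left s = M + (n ∸ s)

  s+left : ∀ {s} → s ≤ n → s + left s ≡ M + n
  s+left {s} s≤n = begin
    s + (M + (n ∸ s)) ≡⟨ +-assoc s M (n ∸ s) ⟨
    s + M + (n ∸ s)   ≡⟨ cong (_+ (n ∸ s)) (+-comm s M) ⟩
    M + s + (n ∸ s)   ≡⟨ +-assoc M s (n ∸ s) ⟩
    M + (s + (n ∸ s)) ≡⟨ cong (M +_) (m+[n∸m]≡n s≤n) ⟩
    M + n             ∎
    where open ≡-Reasoning

  Pending : ℕ → ℕ → Fin n → Fin n → Set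
  Pending zero s i j = ⊥
  Pending (suc J) s i j = toℕ j < J * M ⊎ (J * M ≤ toℕ j × toℕ j < M + J * M × s ≤ toℕ i)

  rowMatches : ℕ → ℕ → ℕ
  rowMatches J s = length (filter (row? J) (range s (left s)))

  laterMatches : ℕ → ℕ
  laterMatches J = length (filter (match? 0 (offset J)) (range 0 (M + n)))

  -- K times the length still to be swept plus M times the number of matches still
  -- to be found: finding K matches and advancing by M both lower it by K * M.
  potential : ℕ → ℕ → ℕ
  potential zero s = 0
  potential (suc J) s =
    K * (left s + J * (M + n)) + M * (rowMatches (suc J) s + laterMatches (suc J))

  -- In both cases what remains is an interval with the old right end `M + n`, so no match is
  -- skipped. The disjunction records which kind of progress pays for the pass: `K` matches found,
  -- or `M` positions left behind.
  resume-spec : ∀ J s → s ≤ n → let found = take K (filter (row? J) (range s M))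
                                    s′ = resume M K s found in
    ∃[ l ] s′ + l ≡ M + n × l ≤ left s × (K ≤ length found ⊎ l + M ≡ left s) ×
      filter (row? J) (range s (left s)) ≡ found ++ filter (row? J) (range s′ l)
  resume-spec J s s≤n with K ≤? length (take K (filter (row? J) (range s M)))
  ... | yes full =
    let found = take K (filter (row? J) (range s M))
        (l , l≤M , sum , eq) = filter-range-resume (row? J) K s M full
        s′ = advance s found
    in l + (n ∸ s) ,
       trans (sym (+-assoc s′ l (n ∸ s)))
         (trans (cong (_+ (n ∸ s)) sum) (trans (+-assoc s M (n ∸ s)) (s+left s≤n))) ,
       +-monoˡ-≤ (n ∸ s) l≤M , inj₁ full ,
       (begin
         filter (row? J) (range s (left s))
           ≡⟨ filter-window M ⟩
         filter (row? J) (range s M) ++ filter (row? J) (range (s + M) (n ∸ s))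
           ≡⟨ cong (_++ filter (row? J) (range (s + M) (n ∸ s))) eq ⟩
         (found ++ filter (row? J) (range s′ l)) ++ filter (row? J) (range (s + M) (n ∸ s))
           ≡⟨ ++-assoc found _ _ ⟩
         found ++ filter (row? J) (range s′ l) ++ filter (row? J) (range (s + M) (n ∸ s))
           ≡⟨ cong (λ r → found ++ filter (row? J) (range s′ l) ++ filter (row? J) (range r (n ∸ s))) sum ⟨
         found ++ filter (row? J) (range s′ l) ++ filter (row? J) (range (s′ + l) (n ∸ s))
           ≡⟨ cong (found ++_) (filter-++ (row? J) (range s′ l) _) ⟨
         found ++ filter (row? J) (range s′ l ++ range (s′ + l) (n ∸ s))
           ≡⟨ cong (λ r → found ++ filter (row? J) r) (range-++ s′ l (n ∸ s)) ⟨
         found ++ filter (row? J) (range s′ (l + (n ∸ s))) ∎)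
    where
    open ≡-Reasoning
    filter-window : ∀ m → filter (row? J) (range s (m + (n ∸ s))) ≡
                    filter (row? J) (range s m) ++ filter (row? J) (range (s + m) (n ∸ s))
    filter-window m = trans (cong (filter (row? J)) (range-++ s m (n ∸ s)))
                            (filter-++ (row? J) (range s m) _)
  ... | no ¬full =
    n ∸ s ,
    trans (+-assoc s M (n ∸ s)) (s+left s≤n) ,
    m≤n+m (n ∸ s) M , inj₂ (+-comm (n ∸ s) M) ,
    trans (cong (filter (row? J)) (range-++ s M (n ∸ s)))
      (trans (filter-++ (row? J) (range s M) _)
        (cong (_++ filter (row? J) (range (s + M) (n ∸ s))) (sym (take-all K _ few))))
    where
    -- `take K` came out shorter than `K`, so it cut nothing off and the window holds no further
    -- matches.
    few : length (filter (row? J) (range s M)) ≤ K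
    few with ≤-total (length (filter (row? J) (range s M))) K
    ... | inj₁ le = le
    ... | inj₂ ge = ⊥-elim (¬full (≤-reflexive (sym
          (trans (length-take K _) (m≤n⇒m⊓n≡m ge)))))

  module _ (J s : ℕ) (s<n : s < n) where

    private
      found : List ℕ
      found = take K (filter (row? (suc J)) (range s M))
      s′ l : ℕ
      s′ = resume M K s found
      l = proj₁ (resume-spec (suc J) s (<⇒≤ s<n))
      s′+l : s′ + l ≡ M + n
      s′+l = proj₁ (proj₂ (resume-spec (suc J) s (<⇒≤ s<n)))
      l≤left : l ≤ left s
      l≤left = proj₁ (proj₂ (proj₂ (resume-spec (suc J) s (<⇒≤ s<n))))
      progress : K ≤ length found ⊎ l + M ≡ left s
      progress = proj₁ (proj₂ (proj₂ (proj₂ (resume-spec (suc J) s (<⇒≤ s<n)))))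
      split : filter (row? (suc J)) (range s (left s)) ≡
              found ++ filter (row? (suc J)) (range s′ l)
      split = proj₂ (proj₂ (proj₂ (proj₂ (resume-spec (suc J) s (<⇒≤ s<n)))))
      rest : ℕ
      rest = length (filter (row? (suc J)) (range s′ l))

      s≤s′ : s ≤ s′
      s≤s′ = +-cancelʳ-≤ l s s′ (≤-trans (+-monoʳ-≤ s l≤left)
               (≤-reflexive (trans (s+left (<⇒≤ s<n)) (sym s′+l))))

      row-decreases : K * l + M * rest + K * M ≤ K * left s + M * rowMatches (suc J) s
      row-decreases rewrite trans (cong length split) (length-++ found {filter (row? (suc J)) (range s′ l)})
        with progress
      ... | inj₁ full = begin
        K * l + M * rest + K * M ≡⟨ solve-eq K l M rest ⟩
        K * l + M * (K + rest)   ≤⟨ +-mono-≤ (*-monoʳ-≤ K l≤left) (*-monoʳ-≤ M (+-monoˡ-≤ rest full)) ⟩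
        K * left s + M * (length found + rest) ∎
        where
        open ≤-Reasoning
        solve-eq : ∀ K l M r → K * l + M * r + K * M ≡ K * l + M * (K + r)
        solve-eq = solve-∀
      ... | inj₂ eq = begin
        K * l + M * rest + K * M ≡⟨ solve-eq K l M rest ⟩
        K * (l + M) + M * rest   ≡⟨ cong (λ z → K * z + M * rest) eq ⟩
        K * left s + M * rest    ≤⟨ +-monoʳ-≤ (K * left s) (*-monoʳ-≤ M (m≤n+m rest _)) ⟩
        K * left s + M * (length found + rest) ∎
        where
        open ≤-Reasoning
        solve-eq : ∀ K l M r → K * l + M * r + K * M ≡ K * (l + M) + M * r
        solve-eq = solve-∀

      l≡left : s′ < n → l ≡ left s′
      l≡left s′<n = +-cancelˡ-≡ s′ l (left s′) (trans s′+l (sym (s+left (<⇒≤ s′<n))))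

    potential-decreases : Injective _≡_ _≡_ b → ∀ {J″ s″} → Next n J s′ J″ s″ →
                          potential J″ s″ + K * M ≤ potential (suc J) s
    potential-decreases b-inj (stay s′<n) = begin
      K * (left s′ + J * (M + n)) + M * (rowMatches (suc J) s′ + L) + K * M
        ≡⟨ cong (λ z → K * (z + J * (M + n)) + M * (length (filter (row? (suc J)) (range s′ z)) + L) + K * M)
                (l≡left s′<n) ⟨
      K * (l + J * (M + n)) + M * (rest + L) + K * M
        ≡⟨ solve-eq K l (J * (M + n)) M rest L ⟩
      (K * l + M * rest + K * M) + (K * (J * (M + n)) + M * L)
        ≤⟨ +-monoˡ-≤ _ row-decreases ⟩
      (K * left s + M * rowMatches (suc J) s) + (K * (J * (M + n)) + M * L)
        ≡⟨ solve-eq′ K (left s) (J * (M + n)) M (rowMatches (suc J) s) L ⟩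
      K * (left s + J * (M + n)) + M * (rowMatches (suc J) s + L) ∎
      where
      open ≤-Reasoning
      L = laterMatches (suc J)
      solve-eq : ∀ K l j M r L → K * (l + j) + M * (r + L) + K * M ≡ (K * l + M * r + K * M) + (K * j + M * L)
      solve-eq = solve-∀
      solve-eq′ : ∀ K l j M r L → (K * l + M * r) + (K * j + M * L) ≡ K * (l + j) + M * (r + L)
      solve-eq′ = solve-∀
    potential-decreases b-inj (down n≤s′) = begin
      potential J 0 + K * M
        ≤⟨ +-monoˡ-≤ (K * M) (below J) ⟩
      K * (J * (M + n)) + M * laterMatches (suc J) + K * M
        -- The row ends although up to `M` positions beyond `n` may be left in it. Their share of
        -- the potential is added back so that `row-decreases` applies.
        ≤⟨ m≤m+n _ (K * l + M * rest) ⟩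
      K * (J * (M + n)) + M * laterMatches (suc J) + K * M + (K * l + M * rest)
        ≡⟨ solve-eq K l (J * (M + n)) M rest (laterMatches (suc J)) ⟩
      (K * l + M * rest + K * M) + (K * (J * (M + n)) + M * laterMatches (suc J))
        ≤⟨ +-monoˡ-≤ _ row-decreases ⟩
      (K * left s + M * rowMatches (suc J) s) + (K * (J * (M + n)) + M * laterMatches (suc J))
        ≡⟨ solve-eq′ K (left s) (J * (M + n)) M (rowMatches (suc J) s) (laterMatches (suc J)) ⟩
      K * (left s + J * (M + n)) + M * (rowMatches (suc J) s + laterMatches (suc J)) ∎
      where
      open ≤-Reasoning
      solve-eq : ∀ K l j M r L → K * j + M * L + K * M + (K * l + M * r) ≡ (K * l + M * r + K * M) + (K * j + M * L)
      solve-eq = solve-∀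
      solve-eq′ : ∀ K l j M r L → (K * l + M * r) + (K * j + M * L) ≡ K * (l + j) + M * (r + L)
      solve-eq′ = solve-∀
      below : ∀ J → potential J 0 ≤ K * (J * (M + n)) + M * laterMatches (suc J)
      below zero = z≤n
      below (suc J) = +-monoʳ-≤ (K * (M + n + J * (M + n))) (*-monoʳ-≤ M
        (matches-+-≤ b-inj J (range 0 (M + n))))

    -- The invariant of the sweep: a pending collision is either among those found in this pass or
    -- still pending afterwards. If the row is left, a collision of its block that was not found
    -- would have `n ≤ s′ ≤ toℕ i`, which is impossible.
    pending-step : ∀ {J″ s″} → Next n J s′ J″ s″ → ∀ {i j} → a i ≡ b j →
      (toℕ i ∈ found × J * M ≤ toℕ j × toℕ j < M + J * M ⊎ Pending J″ s″ i j) ⇔ Pending (suc J) s i j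
    pending-step next {i} {j} ai≡bj = mk⇔ (to next) (from next)
      where
      found⊆ : ∀ {i} → i ∈ found → s ≤ i
      found⊆ i∈ = proj₁ (∈-range⁻ (left s) (proj₁ (∈-filter⁻ (row? (suc J))
        (subst (_ ∈_) (sym split) (∈-++⁺ˡ i∈)))))

      to : ∀ {J″ s″} → Next n J s′ J″ s″ →
           toℕ i ∈ found × J * M ≤ toℕ j × toℕ j < M + J * M ⊎ Pending J″ s″ i j → Pending (suc J) s i j
      to next (inj₁ (i∈ , lo , hi)) = inj₂ (lo , hi , found⊆ i∈)
      to (stay _) (inj₂ (inj₁ later)) = inj₁ later
      to (stay _) (inj₂ (inj₂ (lo , hi , s′≤))) = inj₂ (lo , hi , ≤-trans s≤s′ s′≤)
      to (down _) (inj₂ p) = inj₁ (below J p)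
        where
        below : ∀ J → Pending J 0 i j → toℕ j < J * M
        below (suc J) (inj₁ hi) = ≤-trans hi (m≤n+m (J * M) M)
        below (suc J) (inj₂ (_ , hi , _)) = hi

      unreached : J * M ≤ toℕ j → toℕ j < M + J * M → s ≤ toℕ i →
                  toℕ i ∈ found ⊎ (s′ ≤ toℕ i)
      unreached lo hi s≤i with ∈-++⁻ found (subst (toℕ i ∈_) split
        (∈-filter⁺ (row? (suc J))
          (∈-range⁺ (left s) s≤i (≤-trans (toℕ<n i) (≤-trans (m≤n+m n M) (≤-reflexive (sym (s+left (<⇒≤ s<n)))))))
          (toℕ<n i , j , lo , hi , trans (cong a (clamp-toℕ i)) ai≡bj)))
      ... | inj₁ i∈ = inj₁ i∈
      ... | inj₂ i∈ = inj₂ (proj₁ (∈-range⁻ l (proj₁ (∈-filter⁻ (row? (suc J)) i∈))))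

      from : ∀ {J″ s″} → Next n J s′ J″ s″ → Pending (suc J) s i j →
           toℕ i ∈ found × J * M ≤ toℕ j × toℕ j < M + J * M ⊎ Pending J″ s″ i j
      from (stay _) (inj₁ later) = inj₂ (inj₁ later)
      from (down _) (inj₁ later) = inj₂ (above J later)
        where
        above : ∀ J → toℕ j < J * M → Pending J 0 i j
        above (suc J) hi with toℕ j <? J * M
        ... | yes lt = inj₁ lt
        ... | no ge = inj₂ (≮⇒≥ ge , hi , z≤n)
      from next (inj₂ (lo , hi , s≤i)) with unreached lo hi s≤i
      ... | inj₁ i∈ = inj₁ (i∈ , lo , hi)
      from (stay _) (inj₂ (lo , hi , s≤i)) | inj₂ s′≤ = inj₂ (inj₂ (lo , hi , s′≤))
      from (down n≤s′) (inj₂ (lo , hi , s≤i)) | inj₂ s′≤ =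
        ⊥-elim (<⇒≱ (toℕ<n i) (≤-trans n≤s′ s′≤))

  -- Since `b` is injective, every index of the first list has at most one partner. The matches in
  -- different blocks therefore never count an index twice, and all together they number at most the
  -- `M + n` positions of a row.
  potential-start : Injective _≡_ _≡_ b → ∀ J → potential J 0 ≤ K * (J * (M + n)) + M * (M + n)
  potential-start b-inj zero = z≤n
  potential-start b-inj (suc J) = +-monoʳ-≤ (K * (M + n + J * (M + n))) (*-monoʳ-≤ M (≤-trans
    (matches-+-≤ b-inj J (range 0 (M + n)))
    (≤-trans (length-filter (match? 0 (M + J * M)) (range 0 (M + n))) (≤-reflexive (length-range 0 (M + n))))))

-- The algorithm

-- The masked copy of an input to a distinctness test: hidden positions are
-- filled with elements that occur nowhere else.
module Mask {n d : ℕ} .{{_ : NonZero n}} (M : ℕ) where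

  Visible : (s o lo len : ℕ) → Fin M ⊎ Fin M → Set
  Visible s o lo len (inj₁ p) = s + toℕ p < n × lo ≤ s + toℕ p × s + toℕ p < lo + len
  Visible s o lo len (inj₂ q) = o + toℕ q < n

  visible? : ∀ s o lo len → Decidable (Visible s o lo len)
  visible? s o lo len (inj₁ p) = (_ <? n) ×-dec (lo ≤? _) ×-dec (_ <? lo + len)
  visible? s o lo len (inj₂ q) = _ <? n

  address : (s o : ℕ) → Fin M ⊎ Fin M → Fin (n + n)
  address s o (inj₁ p) = clamp (s + toℕ p) ↑ˡ n
  address s o (inj₂ q) = n ↑ʳ clamp (o + toℕ q)

  -- A hidden position shows its own index, tagged as a dummy, so dummies differ from each other and
  -- from all values. The address read does not depend on `lo` and `len`, so copies for different
  -- intervals agree on what they read.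
  mask : (s o lo len : ℕ) → Fin (M + M) → Fin d → Fin d ⊎ Fin (M + M)
  mask s o lo len r v with visible? s o lo len (splitAt M r)
  ... | yes _ = inj₁ v
  ... | no _ = inj₂ r

  module Detection (x : Input (n + n) d) (s o lo len : ℕ) where

    a b : Fin n → Fin d
    a i = x (i ↑ˡ n)
    b j = x (n ↑ʳ j)

    masked : Fin (M + M) → Fin d ⊎ Fin (M + M)
    masked r = mask s o lo len r (x (address s o (splitAt M r)))

    Hit : ℕ → Set
    Hit i = (s ≤ i × i < s + M) × Sweep.Match M 0 a b o (M + o) i

    reveal : ∀ r {w} → splitAt M r ≡ w → Visible s o lo len w →
             masked r ≡ inj₁ (x (address s o w))
    reveal r refl v with visible? s o lo len (splitAt M r)
    ... | yes _ = refl
    ... | no ¬v = ⊥-elim (¬v v)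

    masked-a : ∀ i → s ≤ i → i < s + M → i < n → lo ≤ i → i < lo + len →
               ∃[ p ] masked (p ↑ˡ M) ≡ inj₁ (a (clamp i))
    masked-a i s≤i i<s+M i<n lo≤i i<lo+len =
      p , trans (reveal (p ↑ˡ M) (splitAt-↑ˡ M p M)
            (subst (λ i → i < n × lo ≤ i × i < lo + len) (sym s+p) (i<n , lo≤i , i<lo+len)))
          (cong (inj₁ ∘ a ∘ clamp) s+p)
      where
      i∸s<M : i ∸ s < M
      i∸s<M = +-cancelˡ-< s (i ∸ s) M (subst (_< s + M) (sym (m+[n∸m]≡n s≤i)) i<s+M)
      p : Fin M
      p = fromℕ< i∸s<M
      s+p : s + toℕ p ≡ i
      s+p = trans (cong (s +_) (toℕ-fromℕ< i∸s<M)) (m+[n∸m]≡n s≤i)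

    masked-b : ∀ j → o ≤ toℕ j → toℕ j < M + o → ∃[ q ] masked (M ↑ʳ q) ≡ inj₁ (b j)
    masked-b j o≤j j<M+o =
      q , trans (reveal (M ↑ʳ q) (splitAt-↑ʳ M M q) (subst (_< n) (sym o+q) (toℕ<n j)))
          (cong (inj₁ ∘ b) (trans (cong clamp o+q) (clamp-toℕ j)))
      where
      j∸o<M : toℕ j ∸ o < M
      j∸o<M = +-cancelʳ-< o (toℕ j ∸ o) M (subst (_< M + o) (sym (m∸n+n≡m o≤j)) j<M+o)
      q : Fin M
      q = fromℕ< j∸o<M
      o+q : o + toℕ q ≡ toℕ j
      o+q = trans (cong (o +_) (toℕ-fromℕ< j∸o<M)) (m+[n∸m]≡n o≤j)

    injective⇒no-hit : Injective _≡_ _≡_ masked → ∀ {i} → lo ≤ i → i < lo + len → ¬ Hit i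
    injective⇒no-hit inj {i} lo≤i i<lo+len ((s≤i , i<s+M) , i<n , j , o≤j , j<M+o , ai≡bj)
      with masked-a i s≤i i<s+M i<n lo≤i i<lo+len | masked-b j o≤j j<M+o
    ... | p , eqp | q , eqq
      with trans (sym (splitAt-↑ˡ M p M)) (trans
             (cong (splitAt M) (inj (trans eqp (trans (cong inj₁ ai≡bj) (sym eqq)))))
             (splitAt-↑ʳ M M q))
    ... | ()

    data View (r : Fin (M + M)) : Fin d ⊎ Fin (M + M) → Set where
      hidden : View r (inj₂ r)
      shown  : ∀ w → splitAt M r ≡ w → Visible s o lo len w → View r (inj₁ (x (address s o w)))

    view : ∀ r → View r (masked r)
    view r with visible? s o lo len (splitAt M r)
    ... | yes v = shown _ refl v
    ... | no _ = hidden

    clamp-injective : ∀ {i j} → i < n → j < n → clamp i ≡ clamp j → i ≡ j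
    clamp-injective i<n j<n eq = trans (sym (toℕ-clamp i<n)) (trans (cong toℕ eq) (toℕ-clamp j<n))

    splitAt-injective : ∀ {r r′} → splitAt M r ≡ splitAt M r′ → r ≡ r′
    splitAt-injective {r} {r′} eq =
      trans (sym (join-splitAt M M r)) (trans (cong (join M M) eq) (join-splitAt M M r′))

    hit : ∀ p q → s + toℕ p < n → o + toℕ q < n →
          a (clamp (s + toℕ p)) ≡ b (clamp (o + toℕ q)) → Hit (s + toℕ p)
    hit p q p<n q<n eq =
      (m≤m+n s (toℕ p) , +-monoʳ-< s (toℕ<n p)) , p<n , clamp (o + toℕ q) ,
      subst (o ≤_) (sym (toℕ-clamp q<n)) (m≤m+n o (toℕ q)) ,
      subst (_< M + o) (trans (+-comm (toℕ q) o) (sym (toℕ-clamp q<n))) (+-monoˡ-< o (toℕ<n q)) , eq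

    -- Equal entries are never a dummy and a value, and equal dummies have equal positions. Within
    -- one list the promise excludes repetitions. Only a coincidence across the two lists is left,
    -- and that is a hit.
    no-hit⇒injective : Injective _≡_ _≡_ a → Injective _≡_ _≡_ b →
                       (∀ {i} → lo ≤ i → i < lo + len → ¬ Hit i) → Injective _≡_ _≡_ masked
    no-hit⇒injective a-inj b-inj no-hit {r} {r′} eq with masked r | view r | masked r′ | view r′
    no-hit⇒injective a-inj b-inj no-hit {r} {r′} eq | _ | hidden | _ | hidden = inj₂-injective eq
    no-hit⇒injective a-inj b-inj no-hit {r} {r′} eq | _ | shown (inj₁ p) eqp (p<n , _) | _ | shown (inj₁ p′) eqp′ (p′<n , _) =
      splitAt-injective (trans eqp (trans (cong inj₁ (toℕ-injective (+-cancelˡ-≡ s _ _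
        (clamp-injective p<n p′<n (a-inj (inj₁-injective eq)))))) (sym eqp′)))
    no-hit⇒injective a-inj b-inj no-hit {r} {r′} eq | _ | shown (inj₂ q) eqq q<n | _ | shown (inj₂ q′) eqq′ q′<n =
      splitAt-injective (trans eqq (trans (cong inj₂ (toℕ-injective (+-cancelˡ-≡ o _ _
        (clamp-injective q<n q′<n (b-inj (inj₁-injective eq)))))) (sym eqq′)))
    no-hit⇒injective a-inj b-inj no-hit {r} {r′} eq | _ | shown (inj₁ p) _ (p<n , lo≤ , <hi) | _ | shown (inj₂ q) _ q<n =
      ⊥-elim (no-hit lo≤ <hi (hit p q p<n q<n (inj₁-injective eq)))
    no-hit⇒injective a-inj b-inj no-hit {r} {r′} eq | _ | shown (inj₂ q) _ q<n | _ | shown (inj₁ p) _ (p<n , lo≤ , <hi) =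
      ⊥-elim (no-hit lo≤ <hi (hit p q p<n q<n (inj₁-injective (sym eq))))

∉⇒≡[] : ∀ {A : Set} {xs : List A} → (∀ {x} → ¬ x ∈ xs) → xs ≡ []
∉⇒≡[] {xs = []} _ = refl
∉⇒≡[] {xs = x ∷ xs} ∉ = ⊥-elim (∉ (here refl))

hits : ∀ {n d k} → Vec (Maybe (Fin n)) k → Vec (Fin d) k → Fin n → Fin d → List (Collision n d)
hits [] [] j v = []
hits (nothing ∷ xs) (u ∷ us) j v = hits xs us j v
hits (just i ∷ xs) (u ∷ us) j v with u ≟ᶠ v
... | yes _ = (i , j , v) ∷ hits xs us j v
... | no _ = hits xs us j v

∈-hits : ∀ {n d k} (a : Fin n → Fin d) (xs : Vec (Maybe (Fin n)) k) us j v →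
  (∀ k {i} → lookup xs k ≡ just i → lookup us k ≡ a i) →
  ∀ {i j′ v′} → (i , j′ , v′) ∈ hits xs us j v ⇔ (i ∈ live xs × a i ≡ v × j′ ≡ j × v′ ≡ v)
∈-hits a [] [] j v us≡ = mk⇔ (λ ()) (λ ())
∈-hits a (nothing ∷ xs) (u ∷ us) j v us≡ = ∈-hits a xs us j v (us≡ ∘ suc)
∈-hits a (just i₀ ∷ xs) (u ∷ us) j v us≡ {i} {j′} {v′}
  with u ≟ᶠ v | ∈-hits a xs us j v (us≡ ∘ suc) {i} {j′} {v′}
... | yes u≡v | IH = mk⇔
  (λ { (here refl) → here refl , trans (sym (us≡ zero refl)) u≡v , refl , refl
     ; (there h) → let (i∈ , r) = Equivalence.to IH h in there i∈ , r })
  (λ { (here refl , _ , refl , refl) → here refl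
     ; (there i∈ , r) → there (Equivalence.from IH (i∈ , r)) })
... | no u≢v | IH = mk⇔
  (λ h → let (i∈ , r) = Equivalence.to IH h in there i∈ , r)
  (λ { (here refl , eq , _) → ⊥-elim (u≢v (trans (us≡ zero refl) eq))
     ; (there i∈ , r) → Equivalence.from IH (i∈ , r) })

-- The window length is a power of two so that intervals halve exactly, down to single positions.
-- Between passes only the number of remaining blocks and the start of the window are kept.
module Algorithm {n d : ℕ} .{{_ : NonZero n}} (e K′ g : ℕ) where

  M K : ℕ
  M = 2 ^ suc e
  K = suc K′

  State : Set
  State = Fin (suc g) × Fin n

  Slots : Set
  Slots = Vec (Maybe (Fin n)) K

  module _ {d′ T : ℕ} (p : DecisionProgram (M + M) d′ T) (solves : SolvesElementDistinctness p)
           (d+2M≤d′ : d + (M + M) ≤ d′)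
           {τ ω : ℕ} (tester : Tester p (n + n) d (Collision n d) (K * 2) τ ω)
           {γ ℓ δ S : ℕ} (coded-J : Coded (Fin (suc g)) γ) (coded-i : Coded (Fin n) ℓ)
           (coded-v : Coded (Fin d) δ)
           (test-fits : ((γ + ℓ) + (K * 2) * suc ℓ) + ω ≤ S)
           (scan-fits : ((γ + ℓ) + K * suc ℓ) + K * δ ≤ S) where

    open Tester tester
    open Mask {n} {d} M

    private
      P : Set → Set → ℕ → Set₁
      P = Prog (n + n) d (Collision n d) S

    row-offset : State → ℕ
    row-offset (J , s) = pred (toℕ J) * M

    embed : Fin d ⊎ Fin (M + M) → Fin d′
    embed = λ v → inject≤ (join d (M + M) v) d+2M≤d′

    embed-injective : Injective _≡_ _≡_ embed
    embed-injective {v} {v′} eq = trans (sym (splitAt-join d (M + M) v))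
      (trans (cong (splitAt d) (inject≤-injective d+2M≤d′ d+2M≤d′ _ _ eq)) (splitAt-join d (M + M) v′))

    right : ℕ → Fin n → Maybe (Fin n)
    right h lo with toℕ lo + 2 ^ h <? n
    ... | yes _ = just (clamp (toℕ lo + 2 ^ h))
    ... | no _ = nothing

    -- An empty slot is tested as if it held 0; the answer is ignored.
    start : Maybe (Fin n) → Fin n
    start = fromMaybe (clamp 0)

    loc : State × Vec (Maybe (Fin n)) (K * 2) → Fin (M + M) → Fin (n + n)
    loc (σ@(_ , s) , _) r = address (toℕ s) (row-offset σ) (splitAt M r)

    val : ℕ → State × Vec (Maybe (Fin n)) (K * 2) → Fin (K * 2) → Fin (M + M) → Fin d → Fin d′
    val h (σ@(_ , s) , cs) k r v =
      embed (mask (toℕ s) (row-offset σ) (toℕ (start (lookup cs k))) (2 ^ h) r v)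

    coded-State : Coded State (γ + ℓ)
    coded-State = coded-× coded-J coded-i

    coded-children : Coded (State × Vec (Maybe (Fin n)) (K * 2)) ((γ + ℓ) + (K * 2) * suc ℓ)
    coded-children = coded-× coded-State (coded-Vec (K * 2) (coded-Maybe coded-i))

    coded-Slots : Coded (State × Slots) ((γ + ℓ) + K * suc ℓ)
    coded-Slots = coded-× coded-State (coded-Vec K (coded-Maybe coded-i))

    coded-values : Coded ((State × Slots) × Vec (Fin d) K) S
    coded-values = coded-≤ scan-fits (coded-× coded-Slots (coded-Vec K coded-v))

    -- Up to `2K` halves may survive the test; `pad K` fills empty slots but also cuts the list back
    -- to its first `K` entries.
    level : ℕ → P (State × Slots) (State × Slots) τ
    level h = premap (λ (σ , L) → σ , children (right h) L)
      (postmap (λ ((σ , cs) , bs) → σ , pad K (discard cs bs))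
        (test coded-children test-fits loc (val h)))

    search : ∀ h → P (State × Slots) (State × Slots) (h * τ)
    search zero = ret id
    search (suc h) = level h ⨾ search h

    slot-loc : State × Slots → Fin K → Fin (n + n)
    slot-loc (_ , L) k = start (lookup L k) ↑ˡ n

    -- The search only locates indices of the first list. With their values in memory, one scan of
    -- the block finds all partners, so reporting costs `K + M` queries.
    collect : P ((State × Slots) × Vec (Fin d) K) (State × Slots) K
    collect = gather K coded-Slots coded-v scan-fits slot-loc

    report-loc : (State × Slots) × Vec (Fin d) K → Fin M → Fin (n + n)
    report-loc ((σ , _) , _) q = n ↑ʳ clamp (row-offset σ + toℕ q)

    -- The number of passes is fixed in advance; a sweep that ends early idles with zero blocks
    -- left, and these passes are made silent.
    report-out : (State × Slots) × Vec (Fin d) K → Fin M → Fin d → List (Collision n d)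
    report-out (((zero , _) , _) , _) q v = []
    report-out ((σ@(suc _ , _) , L) , us) q v with row-offset σ + toℕ q <? n
    ... | yes _ = hits L us (clamp (row-offset σ + toℕ q)) v
    ... | no _ = []

    report : P ((State × Slots) × Vec (Fin d) K) ((State × Slots) × Vec (Fin d) K) M
    report = scan M coded-values report-loc report-out

    next : State × Slots → State
    next ((zero , s) , L) = zero , s
    next ((suc J , s) , L) with resume M K (toℕ s) (map toℕ (live L)) <? n
    ... | yes _ = suc J , clamp (resume M K (toℕ s) (map toℕ (live L)))
    ... | no _ = inject₁ J , clamp 0

    pass : P State State (suc e * τ + (K + M))
    pass = premap (λ σ → σ , pad K (proj₂ σ ∷ [])) (search (suc e)) ⨾
           collect ⨾ postmap (next ∘ proj₁) report

    next-spec : ∀ J s L → let (J′ , s′) = next ((suc J , s) , L) in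
                Next n (toℕ J) (resume M K (toℕ s) (map toℕ (live L))) (toℕ J′) (toℕ s′)
    next-spec J s L with resume M K (toℕ s) (map toℕ (live L)) <? n
    ... | yes <n = subst (Next n (toℕ J) _ (suc (toℕ J))) (sym (toℕ-clamp <n)) (stay <n)
    ... | no ≥n = subst₂ (Next n (toℕ J) _) (sym (toℕ-inject₁ J)) (sym (toℕ-clamp (>-nonZero⁻¹ n))) (down (≮⇒≥ ≥n))

    ∈-emitted-report : ∀ x J s L us → (∀ k {i} → lookup L k ≡ just i → lookup us k ≡ x (i ↑ˡ n)) →
      ∀ {i j v} → (i , j , v) ∈ emitted report x (((suc J , s) , L) , us) ⇔
        ((i ∈ live L × toℕ J * M ≤ toℕ j × toℕ j < M + toℕ J * M) × x (i ↑ˡ n) ≡ x (n ↑ʳ j) × x (n ↑ʳ j) ≡ v)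
    ∈-emitted-report x J s L us us≡ {i} {j} {v} = mk⇔ (to ∘ Scan.to) (Scan.from ∘ from)
      where
      o : ℕ
      o = toℕ J * M

      a b : Fin n → Fin d
      a i = x (i ↑ˡ n)
      b j = x (n ↑ʳ j)

      F : (State × Slots) × Vec (Fin d) K
      F = ((suc J , s) , L) , us

      module Scan = Equivalence (∈-emitted-scan M coded-values report-loc report-out x F {i , j , v})
      module Hits (q : Fin M) = Equivalence
        (∈-hits a L us (clamp (o + toℕ q)) (x (report-loc F q)) us≡ {i} {j} {v})

      to : (∃[ q ] (i , j , v) ∈ report-out F q (x (report-loc F q))) →
           (i ∈ live L × o ≤ toℕ j × toℕ j < M + o) × a i ≡ b j × b j ≡ v
      to (q , h) with o + toℕ q <? n
      ... | yes <n with Hits.to q h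
      ...   | i∈ , ai≡ , refl , refl =
        (i∈ , subst (o ≤_) (sym (toℕ-clamp <n)) (m≤m+n o (toℕ q)) ,
         subst (_< M + o) (trans (+-comm (toℕ q) o) (sym (toℕ-clamp <n))) (+-monoˡ-< o (toℕ<n q))) ,
        ai≡ , refl

      from : (i ∈ live L × o ≤ toℕ j × toℕ j < M + o) × a i ≡ b j × b j ≡ v →
             ∃[ q ] (i , j , v) ∈ report-out F q (x (report-loc F q))
      from ((i∈ , lo , hi) , ai≡bj , bj≡v) = q , reported
        where
        j∸o<M : toℕ j ∸ o < M
        j∸o<M = +-cancelʳ-< o (toℕ j ∸ o) M (subst (_< M + o) (sym (m∸n+n≡m lo)) hi)
        q : Fin M
        q = fromℕ< j∸o<M
        o+q : o + toℕ q ≡ toℕ j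
        o+q = trans (cong (o +_) (toℕ-fromℕ< j∸o<M)) (m+[n∸m]≡n lo)
        at-j : clamp (o + toℕ q) ≡ j
        at-j = trans (cong clamp o+q) (clamp-toℕ j)
        reported : (i , j , v) ∈ report-out F q (x (report-loc F q))
        reported with o + toℕ q <? n
        ... | yes _ = Hits.from q (i∈ , trans ai≡bj (cong b (sym at-j)) , sym at-j ,
                                   trans (sym bj≡v) (cong b (sym at-j)))
        ... | no ≥n = ⊥-elim (≥n (subst (_< n) (sym o+q) (toℕ<n j)))

    emitted-report-done : ∀ x s L us → emitted report x (((zero , s) , L) , us) ≡ []
    emitted-report-done x s L us = ∉⇒≡[] λ o∈ →
      none (Equivalence.to (∈-emitted-scan M coded-values report-loc report-out x (((zero , s) , L) , us)) o∈)
      where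
      none : ∀ {o} → ¬ (∃[ q ] o ∈ report-out (((zero , s) , L) , us) q (x (report-loc (((zero , s) , L) , us) q)))
      none (q , ())

    -- Correctness of the search, of a pass and of the whole sweep

    module Correctness (x : Input (n + n) d)
                       (a-inj : Injective _≡_ _≡_ (λ i → x (i ↑ˡ n)))
                       (b-inj : Injective _≡_ _≡_ (λ j → x (n ↑ʳ j))) where

      a b : Fin n → Fin d
      a i = x (i ↑ˡ n)
      b j = x (n ↑ʳ j)

      open Sweep M K a b

      module Search (σ : State) where

        s o : ℕ
        s = toℕ (proj₂ σ)
        o = row-offset σ

        Hit : ℕ → Set
        Hit i = (s ≤ i × i < s + M) × Match o (M + o) i

        hit? : Decidable Hit
        hit? i = ((s ≤? i) ×-dec (i <? s + M)) ×-dec match? o (M + o) i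

        events : ℕ → Fin n → List ℕ
        events h lo = filter hit? (range (toℕ lo) (2 ^ h))

        Nonempty : ℕ → Fin n → Set
        Nonempty h lo = 0 < length (events h lo)

        events-split : ∀ h lo → events (suc h) lo ≡ events h lo ++ maybe′ (events h) [] (right h lo)
        events-split h lo = trans
          (cong (filter hit?) (trans (cong (λ w → range (toℕ lo) (2 ^ h + w)) (+-identityʳ (2 ^ h)))
                                     (range-++ (toℕ lo) (2 ^ h) (2 ^ h))))
          (trans (filter-++ hit? (range (toℕ lo) (2 ^ h)) _) (cong (events h lo ++_) upper))
          where
          upper : filter hit? (range (toℕ lo + 2 ^ h) (2 ^ h)) ≡ maybe′ (events h) [] (right h lo)
          upper with toℕ lo + 2 ^ h <? n
          ... | yes <n = cong (λ r → filter hit? (range r (2 ^ h))) (sym (toℕ-clamp <n))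
          -- A right half that starts at or beyond `n` gets no slot; it is empty of events because
          -- `Match` demands `i < n`.
          ... | no ≥n = ∉⇒≡[] λ i∈ →
            let (i∈range , _ , i<n , _) = ∈-filter⁻ hit? {xs = range (toℕ lo + 2 ^ h) (2 ^ h)} i∈
            in ≥n (≤-<-trans (proj₁ (∈-range⁻ (2 ^ h) i∈range)) i<n)

        module _ (h : ℕ) (lo : Fin n) where

          open Detection x s o (toℕ lo) (2 ^ h) using (masked; injective⇒no-hit; no-hit⇒injective)

          verdict : Bool
          verdict = decide p (embed ∘ masked)

          accept⇒empty : verdict ≡ true → events h lo ≡ []
          accept⇒empty accept = ∉⇒≡[] λ i∈ →
            let (i∈range , hit) = ∈-filter⁻ hit? {xs = range (toℕ lo) (2 ^ h)} i∈
                (lo≤i , i<hi) = ∈-range⁻ (2 ^ h) i∈range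
            in injective⇒no-hit (λ eq → Equivalence.to (solves _) accept (cong embed eq)) lo≤i i<hi hit

          reject⇒nonempty : verdict ≡ false → Nonempty h lo
          reject⇒nonempty reject with events h lo in eq
          ... | _ ∷ _ = z<s
          ... | [] with trans (sym reject) (Equivalence.from (solves _)
            (λ {r} {r′} same → no-hit⇒injective a-inj b-inj
              (λ lo≤i i<hi hit → ∉[] (subst (_ ∈_) eq (∈-filter⁺ hit? (∈-range⁺ (2 ^ h) lo≤i i<hi) hit)))
              {r} {r′} (embed-injective same)))
            where
            ∉[] : ∀ {i : ℕ} → ¬ i ∈ []
            ∉[] ()
          ... | ()

        -- What a round preserves is the list of the first `K` events in slot order. Splitting the
        -- intervals and dropping empty halves leaves the whole list of events unchanged; cutting
        -- back to `K` nonempty slots leaves its first `K` entries unchanged.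
        level-spec : ∀ h L → ∃[ L′ ] result (level h) x (σ , L) ≡ (σ , L′) ×
          take K (concatMap (events h) (live L′)) ≡ take K (concatMap (events (suc h)) (live L)) ×
          All (Nonempty h) (live L′)
        level-spec h L =
          let cs = children (right h) L
              (bs , eq , labels) = result-test coded-children test-fits loc (val h) x (σ , cs)
              verdicts : ∀ {k lo} → lookup cs k ≡ just lo → lookup bs k ≡ verdict h lo
              verdicts {k} is-lo = trans (labels k)
                (cong (verdict h ∘ start) is-lo)
              kept = discard cs bs
              nonempty : All (Nonempty h) kept
              nonempty = All-discard cs bs λ is-lo rejected →
                reject⇒nonempty h _ (trans (sym (verdicts is-lo)) rejected)
          in pad K kept ,
             trans (result-premap (λ (σ , L) → σ , children (right h) L) (postmap _ (test _ test-fits _ _)) x _)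
               (trans (result-postmap _ (test coded-children test-fits loc (val h)) x _)
                      (cong (λ ((σ , cs) , bs) → σ , pad K (discard cs bs)) eq)) ,
             (begin
               take K (concatMap (events h) (live (pad K kept)))
                 ≡⟨ cong (take K ∘ concatMap (events h)) (live-pad K kept) ⟩
               take K (concatMap (events h) (take K kept))
                 ≡⟨ take-concatMap-take (events h) K nonempty ≤-refl ⟩
               take K (concatMap (events h) kept)
                 ≡⟨ cong (take K) (concatMap-discard (events h) cs bs λ is-lo accepted →
                      accept⇒empty h _ (trans (sym (verdicts is-lo)) accepted)) ⟩
               take K (concatMap (events h) (live cs))
                 ≡⟨ cong (take K) (concatMap-children (events h) (right h) (events-split h) L) ⟩
               take K (concatMap (events (suc h)) (live L)) ∎) ,
             subst (All (Nonempty h)) (sym (live-pad K kept)) (All-take⁺ K nonempty)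
          where open ≡-Reasoning

        search-spec : ∀ h L → All (Nonempty h) (live L) → ∃[ L′ ]
          result (search h) x (σ , L) ≡ (σ , L′) ×
          take K (concatMap (events 0) (live L′)) ≡ take K (concatMap (events h) (live L)) ×
          All (Nonempty 0) (live L′)
        search-spec zero L nonempty = L , refl , refl , nonempty
        search-spec (suc h) L _ =
          let (L₁ , eq₁ , same₁ , nonempty₁) = level-spec h L
              (L₂ , eq₂ , same₂ , nonempty₂) = search-spec h L₁ nonempty₁
          in L₂ , trans (result-⨾ (level h) (search h) x (σ , L)) (trans (cong (result (search h) x) eq₁) eq₂) ,
             trans same₂ same₁ , nonempty₂

        emitted-search : ∀ h L → emitted (search h) x (σ , L) ≡ []
        emitted-search zero L = refl
        emitted-search (suc h) L =
          let (L₁ , eq₁ , _) = level-spec h L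
          in trans (emitted-⨾ (level h) (search h) x (σ , L)) (cong₂ _++_
               (trans (emitted-premap (λ (σ , L) → σ , children (right h) L) (postmap _ (test _ test-fits _ _)) x _)
                 (trans (emitted-postmap _ (test coded-children test-fits loc (val h)) x _)
                        (emitted-test coded-children test-fits loc (val h) x _)))
               (trans (cong (emitted (search h) x) eq₁) (emitted-search h L₁)))

        singletons : ∀ los → All (Nonempty 0) los → concatMap (events 0) los ≡ map toℕ los
        singletons [] [] = refl
        singletons (lo ∷ los) (ne ∷ nes) = cong₂ _++_ (filter-singleton hit? ne) (singletons los nes)

        search-finds : ∃[ L ] result (search (suc e)) x (σ , pad K (proj₂ σ ∷ [])) ≡ (σ , L) ×
          map toℕ (live L) ≡ take K (filter (match? o (M + o)) (range s M))
        search-finds =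
          let L₀ = pad K (proj₂ σ ∷ [])
              -- The initial interval may hold no collision at all, so nonemptiness is available
              -- only after one round. `M = 2 ^ suc e` guarantees that there is one.
              (L₁ , eq₁ , same₁ , nonempty₁) = level-spec e L₀
              (L , eq , same , nonempty) = search-spec e L₁ nonempty₁
          in L , trans (result-⨾ (level e) (search e) x (σ , L₀)) (trans (cong (result (search e) x) eq₁) eq) ,
             (begin
               map toℕ (live L)
                 ≡⟨ take-all K _ (subst (_≤ K) (sym (length-map toℕ (live L))) (length-live L)) ⟨
               take K (map toℕ (live L))
                 ≡⟨ cong (take K) (singletons (live L) nonempty) ⟨
               take K (concatMap (events 0) (live L))
                 ≡⟨ trans same same₁ ⟩
               take K (concatMap (events (suc e)) (live L₀))
                 ≡⟨ cong (take K ∘ concatMap (events (suc e)))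
                      (trans (live-pad K (proj₂ σ ∷ [])) (cong (proj₂ σ ∷_) (take-[] K′))) ⟩
               take K (events (suc e) (proj₂ σ) ++ [])
                 ≡⟨ cong (take K) (++-identityʳ (events (suc e) (proj₂ σ))) ⟩
               take K (filter hit? (range s M))
                 ≡⟨ cong (take K) (filter-cong-∈ hit? (match? o (M + o)) (range s M)
                      (λ _ → proj₂) (λ i∈ m → ∈-range⁻ M i∈ , m)) ⟩
               take K (filter (match? o (M + o)) (range s M)) ∎)
          where open ≡-Reasoning

      found : State → List ℕ
      found σ = take K (filter (match? (row-offset σ) (M + row-offset σ)) (range (toℕ (proj₂ σ)) M))

      private
        prepare : P (State × Slots) State (suc e * τ)
        prepare = premap (λ σ → σ , pad K (proj₂ σ ∷ [])) (search (suc e))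

      abstract

        slots : State → Slots
        slots σ = proj₁ (Search.search-finds σ)

        result-prepare : ∀ σ → result prepare x σ ≡ (σ , slots σ)
        result-prepare σ = trans (result-premap _ (search (suc e)) x σ)
          (proj₁ (proj₂ (Search.search-finds σ)))

        emitted-prepare : ∀ σ → emitted prepare x σ ≡ []
        emitted-prepare σ = trans (emitted-premap _ (search (suc e)) x σ) (Search.emitted-search σ (suc e) _)

        slots-found : ∀ σ → map toℕ (live (slots σ)) ≡ found σ
        slots-found σ = proj₂ (proj₂ (Search.search-finds σ))

      values : State → Vec (Fin d) K
      values σ = tabulate (x ∘ slot-loc (σ , slots σ))

      private
        result-collect : ∀ σ → result collect x (σ , slots σ) ≡ ((σ , slots σ) , values σ)
        result-collect σ = result-gather K coded-Slots coded-v scan-fits slot-loc x (σ , slots σ)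

      result-pass : ∀ σ → result pass x σ ≡ next (σ , slots σ)
      result-pass σ = begin
        result pass x σ
          ≡⟨ result-⨾ prepare (collect ⨾ postmap (next ∘ proj₁) report) x σ ⟩
        result (collect ⨾ postmap (next ∘ proj₁) report) x (result prepare x σ)
          ≡⟨ cong (result (collect ⨾ postmap (next ∘ proj₁) report) x) (result-prepare σ) ⟩
        result (collect ⨾ postmap (next ∘ proj₁) report) x (σ , slots σ)
          ≡⟨ result-⨾ collect (postmap (next ∘ proj₁) report) x _ ⟩
        result (postmap (next ∘ proj₁) report) x (result collect x (σ , slots σ))
          ≡⟨ cong (result (postmap (next ∘ proj₁) report) x) (result-collect σ) ⟩
        result (postmap (next ∘ proj₁) report) x ((σ , slots σ) , values σ)
          ≡⟨ result-postmap (next ∘ proj₁) report x _ ⟩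
        next (proj₁ (result report x ((σ , slots σ) , values σ)))
          ≡⟨ cong (next ∘ proj₁) (result-scan M coded-values report-loc report-out x _) ⟩
        next (σ , slots σ) ∎
        where open ≡-Reasoning

      emitted-pass : ∀ σ → emitted pass x σ ≡ emitted report x ((σ , slots σ) , values σ)
      emitted-pass σ = begin
        emitted pass x σ
          ≡⟨ emitted-⨾ prepare (collect ⨾ postmap (next ∘ proj₁) report) x σ ⟩
        emitted prepare x σ ++ emitted (collect ⨾ postmap (next ∘ proj₁) report) x (result prepare x σ)
          ≡⟨ cong₂ _++_ (emitted-prepare σ)
                        (cong (emitted (collect ⨾ postmap (next ∘ proj₁) report) x) (result-prepare σ)) ⟩
        emitted (collect ⨾ postmap (next ∘ proj₁) report) x (σ , slots σ)
          ≡⟨ emitted-⨾ collect (postmap (next ∘ proj₁) report) x _ ⟩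
        emitted collect x (σ , slots σ) ++ emitted (postmap (next ∘ proj₁) report) x (result collect x (σ , slots σ))
          ≡⟨ cong₂ _++_ (emitted-gather K coded-Slots coded-v scan-fits slot-loc x _)
               (cong (emitted (postmap (next ∘ proj₁) report) x) (result-collect σ)) ⟩
        emitted (postmap (next ∘ proj₁) report) x ((σ , slots σ) , values σ)
          ≡⟨ emitted-postmap (next ∘ proj₁) report x _ ⟩
        emitted report x ((σ , slots σ) , values σ) ∎
        where open ≡-Reasoning

      ∈-slots : ∀ σ {i} → i ∈ live (slots σ) ⇔ toℕ i ∈ found σ
      ∈-slots σ {i} = mk⇔
        (λ i∈ → subst (toℕ i ∈_) eq (∈-map⁺ toℕ i∈))
        (λ i∈ → let (i′ , i′∈ , same) = ∈-map⁻ toℕ (subst (toℕ i ∈_) (sym eq) i∈)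
                in subst (_∈ live (slots σ)) (sym (toℕ-injective same)) i′∈)
        where
        eq : map toℕ (live (slots σ)) ≡ found σ
        eq = slots-found σ

      values-correct : ∀ σ k {i} → lookup (slots σ) k ≡ just i → lookup (values σ) k ≡ a i
      values-correct σ k is-i =
        trans (lookup∘tabulate (x ∘ slot-loc (σ , slots σ)) k)
              (cong (a ∘ start) is-i)

      ∈-emitted-row : ∀ J s {i j v} → let σ = (suc J , s) in
        (i , j , v) ∈ emitted pass x σ ⇔
        ((toℕ i ∈ found σ × toℕ J * M ≤ toℕ j × toℕ j < M + toℕ J * M) × a i ≡ b j × b j ≡ v)
      ∈-emitted-row J s {i} {j} {v} = mk⇔
        (λ o∈ → let ((i∈ , r) , eqs) = Report.to (subst ((i , j , v) ∈_) (emitted-pass σ) o∈)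
                in (Equivalence.to (∈-slots σ) i∈ , r) , eqs)
        (λ ((i∈ , r) , eqs) → subst ((i , j , v) ∈_) (sym (emitted-pass σ))
          (Report.from ((Equivalence.from (∈-slots σ) i∈ , r) , eqs)))
        where
        σ : State
        σ = suc J , s
        module Report = Equivalence
          (∈-emitted-report x J s (slots σ) (values σ) (values-correct σ) {i} {j} {v})

      emitted-done : ∀ s → emitted pass x (zero , s) ≡ []
      emitted-done s = trans (emitted-pass (zero , s)) (emitted-report-done x s _ _)

      next-found : ∀ J s → let σ = (suc J , s) ; σ′ = next (σ , slots σ) in
                   Next n (toℕ J) (resume M K (toℕ s) (found σ)) (toℕ (proj₁ σ′)) (toℕ (proj₂ σ′))
      next-found J s = subst
        (λ found → Next n (toℕ J) (resume M K (toℕ s) found) (toℕ (proj₁ σ′)) (toℕ (proj₂ σ′)))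
        (slots-found σ) (next-spec J s (slots σ))
        where
        σ σ′ : State
        σ = suc J , s
        σ′ = next (σ , slots σ)

      -- The potential acts as fuel, of which each pass with a block left burns `K * M`. With
      -- `R = 0` no block can be left, because `left s ≥ M` makes the potential positive.
      ∈-emitted-repeat : ∀ R J s → potential (toℕ J) (toℕ s) ≤ R * (K * M) → ∀ {i j v} →
        (i , j , v) ∈ emitted (repeat R pass) x (J , s) ⇔
        (Pending (toℕ J) (toℕ s) i j × a i ≡ b j × b j ≡ v)
      ∈-emitted-repeat zero zero s _ = mk⇔ (λ ()) (λ { (() , _) })
      ∈-emitted-repeat (suc R) zero s _ {i} {j} {v} = mk⇔
        (λ o∈ → Equivalence.to IH (subst ((i , j , v) ∈_) unfold o∈))
        (λ { (() , _) })
        where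
        unfold : emitted (repeat (suc R) pass) x (zero , s) ≡ emitted (repeat R pass) x (zero , s)
        unfold = trans (emitted-⨾ pass (repeat R pass) x (zero , s))
          (cong₂ _++_ (emitted-done s) (cong (emitted (repeat R pass) x) (result-pass (zero , s))))
        IH = ∈-emitted-repeat R zero s z≤n {i} {j} {v}
      ∈-emitted-repeat zero (suc J) s Φ≤0 = ⊥-elim (<⇒≱ positive Φ≤0)
        where
        positive : 0 < potential (suc (toℕ J)) (toℕ s)
        positive = ≤-trans (m^n>0 2 (suc e)) (≤-trans (m≤m+n M (n ∸ toℕ s))
          (≤-trans (m≤m+n _ (toℕ J * (M + n))) (≤-trans (m≤m+n _ _) (m≤m+n _ _))))
      ∈-emitted-repeat (suc R) (suc J) s Φ≤ {i} {j} {v} = mk⇔ to from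
        where
        σ σ′ : State
        σ = suc J , s
        σ′ = next (σ , slots σ)
        unfold : emitted (repeat (suc R) pass) x σ ≡ emitted pass x σ ++ emitted (repeat R pass) x σ′
        unfold = trans (emitted-⨾ pass (repeat R pass) x σ)
          (cong (λ σ → emitted pass x (suc J , s) ++ emitted (repeat R pass) x σ) (result-pass σ))
        moves = next-found J s
        module IH = Equivalence (∈-emitted-repeat R (proj₁ σ′) (proj₂ σ′)
          (+-cancelʳ-≤ (K * M) _ _ (≤-trans (potential-decreases (toℕ J) (toℕ s) (toℕ<n s) b-inj moves)
            (≤-trans Φ≤ (≤-reflexive (+-comm (K * M) (R * (K * M))))))) {i} {j} {v})
        module Row = Equivalence (∈-emitted-row J s {i} {j} {v})
        to : (i , j , v) ∈ emitted (repeat (suc R) pass) x σ →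
             Pending (suc (toℕ J)) (toℕ s) i j × a i ≡ b j × b j ≡ v
        to o∈ = split (∈-++⁻ (emitted pass x σ) (subst ((i , j , v) ∈_) unfold o∈))
          where
          split : _ ⊎ _ → Pending (suc (toℕ J)) (toℕ s) i j × a i ≡ b j × b j ≡ v
          split (inj₁ now) = let (w , eq , eq′) = Row.to now in
            Equivalence.to (pending-step (toℕ J) (toℕ s) (toℕ<n s) moves eq) (inj₁ w) , eq , eq′
          split (inj₂ later) = let (w , eq , eq′) = IH.to later in
            Equivalence.to (pending-step (toℕ J) (toℕ s) (toℕ<n s) moves eq) (inj₂ w) , eq , eq′
        from : Pending (suc (toℕ J)) (toℕ s) i j × a i ≡ b j × b j ≡ v →
               (i , j , v) ∈ emitted (repeat (suc R) pass) x σ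
        from (pend , eq , eq′) = subst ((i , j , v) ∈_) (sym unfold)
          (case (Equivalence.from (pending-step (toℕ J) (toℕ s) (toℕ<n s) moves eq) pend))
          where
          case : _ ⊎ _ → (i , j , v) ∈ emitted pass x σ ++ emitted (repeat R pass) x σ′
          case (inj₁ w) = ∈-++⁺ˡ (Row.from (w , eq , eq′))
          case (inj₂ w) = ∈-++⁺ʳ (emitted pass x σ) (IH.from (w , eq , eq′))

    -- As `n ≤ g * M`, the `g` blocks cover the second list, so every collision is pending at the
    -- start; the remaining hypotheses bound the initial potential and the total time.
    setCollisionIn : n ≤ g * M → ∀ {R T′} → K * (g * (M + n)) + M * (M + n) ≤ R * (K * M) →
                     R * (suc e * τ + (K + M)) ≤ T′ → SetCollisionIn n d S T′
    setCollisionIn n≤gM {R} enough time =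
      _ , time , proj₁ program , proj₂ program , λ x a-inj b-inj i j v →
        let open Correctness x a-inj b-inj
            open Sweep M K a b
            Φ≤ : potential (toℕ (fromℕ g)) (toℕ (clamp {n} 0)) ≤ R * (K * M)
            Φ≤ = subst₂ (λ J s → potential J s ≤ R * (K * M)) (sym (toℕ-fromℕ g)) (sym 0≡)
                   (≤-trans (potential-start b-inj g) enough)
            module E = Equivalence (∈-emitted-repeat R (fromℕ g) (clamp 0) Φ≤ {i} {j} {v})
        in mk⇔
          (λ o∈ → proj₂ (E.to (subst ((i , j , v) ∈_) (outputs-toSearchProgram (repeat R pass) _ x) o∈)))
          (λ eqs → subst ((i , j , v) ∈_) (sym (outputs-toSearchProgram (repeat R pass) _ x))
            (E.from (subst₂ (λ J s → Pending J s i j) (sym (toℕ-fromℕ g)) (sym 0≡)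
              (all-pending a b g (≤-trans (toℕ<n j) n≤gM)) , eqs)))
      where
      program = toSearchProgram (repeat R pass) (fromℕ g , clamp 0)
      0≡ : toℕ (clamp {n} 0) ≡ 0
      0≡ = toℕ-clamp (>-nonZero⁻¹ n)
      all-pending : ∀ a b J {i j} → toℕ j < J * M → Sweep.Pending M K a b J 0 i j
      all-pending a b (suc J) {j = j} hi with toℕ j <? J * M
      ... | yes lt = inj₁ lt
      ... | no ge = inj₂ (≮⇒≥ ge , hi , z≤n)

-- Choice of parameters and asymptotics

n≤2^⌈log₂n⌉ : ∀ n → n ≤ 2 ^ ⌈log₂ n ⌉
n≤2^⌈log₂n⌉ = <-rec (λ n → n ≤ 2 ^ ⌈log₂ n ⌉) step
  where
  step : ∀ n → (∀ {m} → m < n → m ≤ 2 ^ ⌈log₂ m ⌉) → n ≤ 2 ^ ⌈log₂ n ⌉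
  step zero rec = z≤n
  step (suc zero) rec = ≤-refl
  step n@(suc (suc m)) rec = begin
    n                             ≡⟨ ⌊n/2⌋+⌈n/2⌉≡n n ⟨
    ⌊ n /2⌋ + ⌈ n /2⌉             ≤⟨ +-monoˡ-≤ ⌈ n /2⌉ (⌊n/2⌋≤⌈n/2⌉ n) ⟩
    ⌈ n /2⌉ + ⌈ n /2⌉             ≤⟨ +-mono-≤ half (≤-trans half (m≤m+n _ 0)) ⟩
    2 ^ suc (⌈log₂ n ⌉ ∸ 1)       ≡⟨ cong (2 ^_) (m+[n∸m]≡n {1} (⌈log₂⌉-mono-≤ {2} {n} (s≤s (s≤s z≤n)))) ⟩
    2 ^ ⌈log₂ n ⌉                 ∎
    where
    open ≤-Reasoning
    half : ⌈ n /2⌉ ≤ 2 ^ (⌈log₂ n ⌉ ∸ 1)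
    half = subst (λ k → ⌈ n /2⌉ ≤ 2 ^ k) (⌈log₂⌈n/2⌉⌉≡⌈log₂n⌉∸1 n) (rec (⌈n/2⌉<n m))

m<[1+m/n]*n : ∀ m n .{{_ : NonZero n}} → m < suc (m / n) * n
m<[1+m/n]*n m n = subst (_< n + m / n * n) (sym (m≡m%n+[m/n]*n m n)) (+-monoˡ-< (m / n * n) (m%n<n m n))

-- Supplies the power of two `2 ^ suc e` that lies above √x but not above 2√x.
√-exponent : ∀ x → 1 ≤ x → ∃[ e ] (2 ^ e) ^ 2 ≤ x × x < (2 ^ suc e) ^ 2
√-exponent (suc zero) _ = 0 , ≤-refl , s≤s (s≤s z≤n)
√-exponent (suc (suc x)) _ with √-exponent (suc x) (s≤s z≤n)
... | e , lo , hi with suc (suc x) <? (2 ^ suc e) ^ 2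
... | yes hi′ = e , m≤n⇒m≤1+n lo , hi′
... | no ¬hi′ = suc e , ≮⇒≥ ¬hi′ ,
  ≤-<-trans hi (^-monoˡ-< 2 (^-monoʳ-< 2 (s≤s (s≤s z≤n)) (n<1+n (suc e))))

-- For `m ≥ 2` both summands are at most `m ^ k * m`, and the factor 2 is absorbed by one more `m`.
-- The added 2 takes care of `m = 0` and `m = 1`.
m^k+m≤m^2+k : ∀ m k → m ^ k + m ≤ m ^ (2 + k) + 2
m^k+m≤m^2+k zero k = ≤-trans (≤-reflexive (+-identityʳ (0 ^ k))) (≤-trans (0^k≤1 k) (s≤s z≤n))
  where
  0^k≤1 : ∀ k → 0 ^ k ≤ 1
  0^k≤1 zero = ≤-refl
  0^k≤1 (suc k) = z≤n
m^k+m≤m^2+k (suc zero) k rewrite ^-zeroˡ k = s≤s (s≤s z≤n)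
m^k+m≤m^2+k m@(suc (suc _)) k = begin
  m ^ k + m                 ≤⟨ +-mono-≤ (m≤m*n (m ^ k) m) (m≤n*m m (m ^ k) {{m^n≢0 m k}}) ⟩
  m ^ k * m + m ^ k * m     ≡⟨ solve-eq (m ^ k) m ⟩
  2 * (m ^ k * m)           ≤⟨ *-monoˡ-≤ (m ^ k * m) {2} {m} (s≤s (s≤s z≤n)) ⟩
  m * (m ^ k * m)           ≡⟨ cong (m *_) (*-comm (m ^ k) m) ⟩
  m ^ (2 + k)               ≤⟨ m≤m+n _ 2 ⟩
  m ^ (2 + k) + 2           ∎
  where
  open ≤-Reasoning
  solve-eq : ∀ a m → a * m + a * m ≡ 2 * (a * m)
  solve-eq = solve-∀

-- Blocks have size about √(nK), so n is at most quadratic in the size m of a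
-- test, and its domain also has room for m dummy elements.
blockDomain : ℕ → ℕ → ℕ
blockDomain c m = (m ^ 2) ^ c + c + m

blockDomain-bounded : ∀ c → PolyBounded (blockDomain c)
blockDomain-bounded c = 2 + (2 * c) , λ m → begin
  (m ^ 2) ^ c + c + m         ≡⟨ cong (λ z → z + c + m) (^-*-assoc m 2 c) ⟩
  m ^ (2 * c) + c + m         ≡⟨ solve-eq (m ^ (2 * c)) c m ⟩
  m ^ (2 * c) + m + c         ≤⟨ +-mono-≤ (m^k+m≤m^2+k m (2 * c)) (m≤m+n c (c + 0)) ⟩
  m ^ (2 + 2 * c) + 2 + 2 * c ≡⟨ +-assoc (m ^ (2 + 2 * c)) 2 (2 * c) ⟩
  m ^ (2 + 2 * c) + (2 + 2 * c) ∎
  where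
  open ≤-Reasoning
  solve-eq : ∀ a c m → a + c + m ≡ a + m + c
  solve-eq = solve-∀


n<2^n : ∀ n → n < 2 ^ n
n<2^n zero = ≤-refl
n<2^n (suc n) = +-mono-≤ (m^n>0 2 n) (≤-trans (n<2^n n) (m≤m+n _ 0))

2^-+ : ∀ a b → 2 ^ a + 2 ^ b ≤ 2 ^ suc (a + b)
2^-+ a b = +-mono-≤ (^-monoʳ-≤ 2 (m≤m+n a b)) (≤-trans (^-monoʳ-≤ 2 (m≤n+m b a)) (m≤m+n _ 0))

module Parameters (c : ℕ) (sᴱ tᴱ : ℕ → ℕ) (n K : ℕ) (1≤K : 1 ≤ K) (K≤n : K ≤ n) where

  instance
    K≢0 : NonZero K
    K≢0 = >-nonZero 1≤K

    n≢0 : NonZero n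
    n≢0 = >-nonZero (≤-trans 1≤K K≤n)

  1≤nK : 1 ≤ n * K
  1≤nK = *-mono-≤ (≤-trans 1≤K K≤n) 1≤K

  e M : ℕ
  e = proj₁ (√-exponent (n * K) 1≤nK)
  M = 2 ^ suc e

  instance
    M≢0 : NonZero M
    M≢0 = m^n≢0 2 (suc e)

  g R ℓ γ δ space time : ℕ
  g = suc (n / M)
  -- A bound on the initial potential in units of `K * M`: since `M + n ≤ suc g * M`, the length to
  -- be swept accounts for `g * suc g` passes and the matches to be found for the rest.
  R = g * suc g + suc ((M + n) / K)
  ℓ = ⌈log₂ n ⌉
  γ = 2 + ℓ
  δ = suc (ℓ * c + c)
  -- Besides its `sᴱ (M + M)` bits, each of the `2K` copies is granted one bit for its answer. In
  -- `time`, the factor 2 allows for two copies run one after the other, which is the sequential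
  -- case `K = 1`.
  space = ((γ + ℓ) + (K * 2) * suc ℓ) + (K * 2) * suc (sᴱ (M + M)) + K * δ
  time = R * (suc e * (2 * tᴱ (M + M)) + (K + M))

  nK≤M² : n * K ≤ M * M
  nK≤M² = <⇒≤ (subst (n * K <_) (cong (M *_) (*-identityʳ M)) (proj₂ (proj₂ (√-exponent (n * K) 1≤nK))))

  M²≤4nK : M * M ≤ 4 * (n * K)
  M²≤4nK = subst (_≤ 4 * (n * K)) (square (2 ^ e)) (*-monoʳ-≤ 4 (proj₁ (proj₂ (√-exponent (n * K) 1≤nK))))
    where
    square : ∀ x → 4 * (x * (x * 1)) ≡ (2 * x) * (2 * x)
    square = solve-∀

  square-cancel-≤ : ∀ {x y} → x * x ≤ y * y → x ≤ y
  square-cancel-≤ {x} {y} le with x ≤? y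
  ... | yes x≤y = x≤y
  ... | no x≰y = ⊥-elim (<⇒≱ (*-mono-< (≰⇒> x≰y) (≰⇒> x≰y)) le)

  K≤M : K ≤ M
  K≤M = square-cancel-≤ (≤-trans (*-monoˡ-≤ K K≤n) nK≤M²)

  M≤2n : M ≤ 2 * n
  M≤2n = square-cancel-≤ (≤-trans M²≤4nK (≤-trans (*-monoʳ-≤ 4 (*-monoʳ-≤ n K≤n))
    (≤-reflexive (square n))))
    where
    square : ∀ n → 4 * (n * n) ≡ (2 * n) * (2 * n)
    square = solve-∀

  n≤M² : n ≤ M * M
  n≤M² = ≤-trans (m≤m*n n K) nK≤M²

  n≤2^ℓ : n ≤ 2 ^ ℓ
  n≤2^ℓ = n≤2^⌈log₂n⌉ n

  n≤gM : n ≤ g * M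
  n≤gM = <⇒≤ (m<[1+m/n]*n n M)

  gM≤M+n : g * M ≤ M + n
  gM≤M+n = +-monoʳ-≤ M (m/n*n≤m n M)

  enough-passes : K * (g * (M + n)) + M * (M + n) ≤ R * (K * M)
  enough-passes = begin
    K * (g * (M + n)) + M * (M + n)
      ≤⟨ +-mono-≤ (*-monoʳ-≤ K (*-monoʳ-≤ g (+-monoʳ-≤ M n≤gM)))
                  (*-monoʳ-≤ M (<⇒≤ (m<[1+m/n]*n (M + n) K))) ⟩
    K * (g * (suc g * M)) + M * (suc ((M + n) / K) * K)
      ≡⟨ solve-eq K g (suc g) M (suc ((M + n) / K)) ⟩
    R * (K * M) ∎
    where
    open ≤-Reasoning
    solve-eq : ∀ K g g′ M q → K * (g * (g′ * M)) + M * (q * K) ≡ (g * g′ + q) * (K * M)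
    solve-eq = solve-∀

  1+g≤2^γ : suc g ≤ 2 ^ γ
  1+g≤2^γ = begin
    2 + n / M                   ≤⟨ +-monoʳ-≤ 2 (m/n≤m n M) ⟩
    2 + n                       ≤⟨ +-mono-≤ (*-monoʳ-≤ 2 (m^n>0 2 ℓ)) (≤-trans n≤2^ℓ (m≤m+n (2 ^ ℓ) _)) ⟩
    2 * 2 ^ ℓ + 2 * 2 ^ ℓ       ≡⟨ solve-eq (2 ^ ℓ) ⟩
    2 ^ γ                       ∎
    where
    open ≤-Reasoning
    solve-eq : ∀ x → 2 * x + 2 * x ≡ 2 * (2 * x)
    solve-eq = solve-∀

  domain≤2^δ : ∀ {d} → d ≤ n ^ c + c → d ≤ 2 ^ δ
  domain≤2^δ {d} d≤ = begin
    d                      ≤⟨ d≤ ⟩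
    n ^ c + c              ≤⟨ +-mono-≤ (^-monoˡ-≤ c n≤2^ℓ) (<⇒≤ (n<2^n c)) ⟩
    (2 ^ ℓ) ^ c + 2 ^ c    ≡⟨ cong (_+ 2 ^ c) (^-*-assoc 2 ℓ c) ⟩
    2 ^ (ℓ * c) + 2 ^ c    ≤⟨ 2^-+ (ℓ * c) c ⟩
    2 ^ δ                  ∎
    where open ≤-Reasoning

  domain≤blockDomain : ∀ {d} → d ≤ n ^ c + c → d + (M + M) ≤ blockDomain c (M + M)
  domain≤blockDomain d≤ = +-monoˡ-≤ (M + M) (≤-trans d≤ (+-monoˡ-≤ c (^-monoˡ-≤ c (begin
    n                 ≤⟨ n≤M² ⟩
    M * M             ≤⟨ *-mono-≤ (m≤m+n M M) (m≤m+n M M) ⟩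
    (M + M) * (M + M) ≡⟨ cong ((M + M) *_) (*-identityʳ (M + M)) ⟨
    (M + M) ^ 2       ∎))))
    where open ≤-Reasoning

  ⌈log₂2M⌉≤2+ℓ : ⌈log₂ M + M ⌉ ≤ 2 + ℓ
  ⌈log₂2M⌉≤2+ℓ = subst (⌈log₂ M + M ⌉ ≤_) (⌈log₂2^n⌉≡n (2 + ℓ)) (⌈log₂⌉-mono-≤ (begin
    M + M                 ≤⟨ +-mono-≤ M≤2n M≤2n ⟩
    2 * n + 2 * n         ≤⟨ +-mono-≤ (*-monoʳ-≤ 2 n≤2^ℓ) (*-monoʳ-≤ 2 n≤2^ℓ) ⟩
    2 * 2 ^ ℓ + 2 * 2 ^ ℓ ≡⟨ solve-eq (2 ^ ℓ) ⟩
    2 ^ (2 + ℓ)           ∎))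
    where
    open ≤-Reasoning
    solve-eq : ∀ x → 2 * x + 2 * x ≡ 2 * (2 * x)
    solve-eq = solve-∀

  1+e≤1+ℓ : suc e ≤ suc ℓ
  1+e≤1+ℓ = subst₂ _≤_ (⌈log₂2^n⌉≡n (suc e)) (⌈log₂2^n⌉≡n (suc ℓ))
    (⌈log₂⌉-mono-≤ (≤-trans M≤2n (*-monoʳ-≤ 2 n≤2^ℓ)))

  -- 31 = 3·5 + 4·3 + 4, from `g * M ≤ 3 * n`, `M ≤ 2 * n` and `M * M ≤ 4 * (n * K)`.
  RM²≤31n² : R * (M * M) ≤ 31 * (n * n)
  RM²≤31n² = begin
    R * (M * M)
      ≡⟨ expand g M ((M + n) / K) ⟩
    g * M * (M + g * M) + (M + n) / K * (M * M) + M * M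
      ≤⟨ +-mono-≤ (+-mono-≤ (*-mono-≤ gM≤3n (+-mono-≤ M≤2n gM≤3n)) (*-monoʳ-≤ ((M + n) / K) M²≤4nK)) (*-mono-≤ M≤2n M≤2n) ⟩
    3 * n * (2 * n + 3 * n) + (M + n) / K * (4 * (n * K)) + 2 * n * (2 * n)
      ≡⟨ cong (λ z → 3 * n * (2 * n + 3 * n) + z + 2 * n * (2 * n)) (regroup ((M + n) / K) n K) ⟩
    3 * n * (2 * n + 3 * n) + 4 * n * ((M + n) / K * K) + 2 * n * (2 * n)
      ≤⟨ +-monoˡ-≤ (2 * n * (2 * n)) (+-monoʳ-≤ (3 * n * (2 * n + 3 * n)) (*-monoʳ-≤ (4 * n)
           (≤-trans (m/n*n≤m (M + n) K) (+-monoˡ-≤ n M≤2n)))) ⟩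
    3 * n * (2 * n + 3 * n) + 4 * n * (2 * n + n) + 2 * n * (2 * n)
      ≡⟨ total n ⟩
    31 * (n * n) ∎
    where
    open ≤-Reasoning
    gM≤3n : g * M ≤ 3 * n
    gM≤3n = ≤-trans gM≤M+n (≤-trans (+-monoˡ-≤ n M≤2n) (≤-reflexive (+-comm (2 * n) n)))
    expand : ∀ g M q → (g * suc g + suc q) * (M * M) ≡ g * M * (M + g * M) + q * (M * M) + M * M
    expand = solve-∀
    regroup : ∀ q n K → q * (4 * (n * K)) ≡ 4 * n * (q * K)
    regroup = solve-∀
    total : ∀ n → 3 * n * (2 * n + 3 * n) + 4 * n * (2 * n + n) + 2 * n * (2 * n) ≡ 31 * (n * n)
    total = solve-∀

  -- `n₁` is the threshold of the bounds for the distinctness solver, which runs on `2M` elements.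
  -- As `n ≤ M²`, its square is enough; the 2 makes `ℓ` positive, so that additive constants are
  -- absorbed by powers of `ℓ`.
  module _ {n₁} (n-large : 2 + n₁ * n₁ ≤ n) where

    1≤ℓ : 1 ≤ ℓ
    1≤ℓ = ⌈log₂⌉-mono-≤ {2} {n} (≤-trans (m≤m+n 2 _) n-large)

    n₁≤2M : n₁ ≤ M + M
    n₁≤2M = ≤-trans (square-cancel-≤ (≤-trans (m≤n+m (n₁ * n₁) 2) (≤-trans n-large n≤M²))) (m≤m+n M M)

    ⌈log₂2M⌉^≤ : ∀ k → ⌈log₂ M + M ⌉ ^ k ≤ 3 ^ k * ℓ ^ k
    ⌈log₂2M⌉^≤ k = ≤-trans (^-monoˡ-≤ k (≤-trans ⌈log₂2M⌉≤2+ℓ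
        (≤-trans (+-monoˡ-≤ ℓ (*-monoʳ-≤ 2 1≤ℓ)) (≤-reflexive (+-comm (2 * ℓ) ℓ)))))
      (≤-reflexive (^-distrib 3 ℓ k))
      where
      ^-distrib : ∀ x y k → (x * y) ^ k ≡ x ^ k * y ^ k
      ^-distrib x y zero = refl
      ^-distrib x y (suc k) = trans (cong (x * y *_) (^-distrib x y k)) (solve-eq x y (x ^ k) (y ^ k))
        where
        solve-eq : ∀ x y a b → x * y * (a * b) ≡ x * a * (y * b)
        solve-eq = solve-∀

    private
      instance
        ℓ≢0 : NonZero ℓ
        ℓ≢0 = >-nonZero 1≤ℓ

    module _ (C k : ℕ) where

      private
        Λ : ℕ
        -- One logarithm more than the solver has: in the time for the rounds of the binary search,
        -- in the space for the bits of a slot.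
        Λ = ℓ ^ suc k

        ℓ≤Λ : ℓ ≤ Λ
        ℓ≤Λ = m≤m*n ℓ (ℓ ^ k) {{m^n≢0 ℓ k}}

        1≤Λ : 1 ≤ Λ
        1≤Λ = ≤-trans 1≤ℓ ℓ≤Λ

        Λ≤KΛ : Λ ≤ K * Λ
        Λ≤KΛ = m≤n*m Λ K

      space-bound : sᴱ (M + M) ≤ C * ⌈log₂ M + M ⌉ ^ k * 1 →
                    space ≤ (11 + 2 * (C * 3 ^ k) + 2 * c) * Λ * K
      space-bound s≤ = begin
        ((γ + ℓ) + (K * 2) * suc ℓ) + (K * 2) * suc (sᴱ (M + M)) + K * δ
          ≤⟨ +-mono-≤ (+-mono-≤ (+-mono-≤ γ+ℓ≤ (*-monoʳ-≤ (K * 2) (+-mono-≤ 1≤Λ ℓ≤Λ)))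
               (*-monoʳ-≤ (K * 2) (+-mono-≤ 1≤Λ s≤′))) (*-monoʳ-≤ K δ≤) ⟩
        4 * (K * Λ) + (K * 2) * (Λ + Λ) + (K * 2) * (Λ + C * 3 ^ k * Λ) + K * (Λ + (Λ * c + c * Λ))
          ≡⟨ total K Λ (C * 3 ^ k) c ⟩
        (11 + 2 * (C * 3 ^ k) + 2 * c) * Λ * K ∎
        where
        open ≤-Reasoning
        γ+ℓ≤ : γ + ℓ ≤ 4 * (K * Λ)
        γ+ℓ≤ = begin
          2 + ℓ + ℓ             ≤⟨ +-mono-≤ (+-mono-≤ (*-monoʳ-≤ 2 1≤Λ) ℓ≤Λ) ℓ≤Λ ⟩
          2 * Λ + Λ + Λ         ≡⟨ four Λ ⟩
          4 * Λ                 ≤⟨ *-monoʳ-≤ 4 Λ≤KΛ ⟩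
          4 * (K * Λ)           ∎
          where
          four : ∀ x → 2 * x + x + x ≡ 4 * x
          four = solve-∀
        s≤′ : sᴱ (M + M) ≤ C * 3 ^ k * Λ
        s≤′ = begin
          sᴱ (M + M)                     ≤⟨ s≤ ⟩
          C * ⌈log₂ M + M ⌉ ^ k * 1      ≡⟨ *-identityʳ _ ⟩
          C * ⌈log₂ M + M ⌉ ^ k          ≤⟨ *-monoʳ-≤ C (⌈log₂2M⌉^≤ k) ⟩
          C * (3 ^ k * ℓ ^ k)            ≡⟨ *-assoc C (3 ^ k) (ℓ ^ k) ⟨
          C * 3 ^ k * ℓ ^ k              ≤⟨ *-monoʳ-≤ (C * 3 ^ k) (m≤n*m (ℓ ^ k) ℓ) ⟩
          C * 3 ^ k * Λ                  ∎
        δ≤ : δ ≤ Λ + (Λ * c + c * Λ)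
        δ≤ = +-mono-≤ 1≤Λ (+-mono-≤ (*-monoˡ-≤ c ℓ≤Λ) (m≤m*n c Λ {{>-nonZero 1≤Λ}}))
        total : ∀ K Λ C c → 4 * (K * Λ) + (K * 2) * (Λ + Λ) + (K * 2) * (Λ + C * Λ) + K * (Λ + (Λ * c + c * Λ))
                          ≡ (11 + 2 * C + 2 * c) * Λ * K
        total = solve-∀

      -- After multiplication by `n`, the inequality `n * K ≤ M * M` bounds the left side by the
      -- square of `M * time`. This turns the number of passes into `R * (M * M)`, already bounded
      -- by a multiple of `n * n`, and avoids square roots and division.
      time-bound : tᴱ (M + M) ≤ C * ⌈log₂ M + M ⌉ ^ k * (M + M) →
                   K * time ^ 2 ≤ (31 * (8 * (C * 3 ^ k) + 2) * Λ) ^ 2 * n ^ 3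
      time-bound t≤ = *-cancelˡ-≤ n (begin
        n * (K * time ^ 2)           ≡⟨ regroup n K time ⟩
        n * K * (time * time)        ≤⟨ *-monoˡ-≤ (time * time) nK≤M² ⟩
        M * M * (time * time)        ≡⟨ squares M time ⟩
        (M * time) * (M * time)      ≤⟨ *-mono-≤ Mtime≤ Mtime≤ ⟩
        (31 * (n * n) * Q) * (31 * (n * n) * Q) ≡⟨ final n (8 * (C * 3 ^ k) + 2) Λ ⟩
        n * ((31 * (8 * (C * 3 ^ k) + 2) * Λ) ^ 2 * n ^ 3) ∎)
        where
        open ≤-Reasoning
        Q : ℕ
        Q = (8 * (C * 3 ^ k) + 2) * Λ
        t≤′ : tᴱ (M + M) ≤ C * 3 ^ k * ℓ ^ k * (M + M)
        t≤′ = ≤-trans t≤ (*-monoˡ-≤ (M + M) (≤-trans (*-monoʳ-≤ C (⌈log₂2M⌉^≤ k))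
                (≤-reflexive (sym (*-assoc C (3 ^ k) (ℓ ^ k))))))
        step≤ : suc e * (2 * tᴱ (M + M)) + (K + M) ≤ M * Q
        step≤ = begin
          suc e * (2 * tᴱ (M + M)) + (K + M)
            ≤⟨ +-mono-≤ (*-mono-≤ (≤-trans 1+e≤1+ℓ (+-mono-≤ 1≤ℓ (≤-reflexive (sym (*-identityˡ ℓ)))))
                                  (*-monoʳ-≤ 2 t≤′)) (+-monoˡ-≤ M K≤M) ⟩
          (ℓ + 1 * ℓ) * (2 * (C * 3 ^ k * ℓ ^ k * (M + M))) + (M + M)
            ≤⟨ +-monoʳ-≤ _ (m≤m*n (M + M) Λ {{>-nonZero 1≤Λ}}) ⟩
          (ℓ + 1 * ℓ) * (2 * (C * 3 ^ k * ℓ ^ k * (M + M))) + (M + M) * Λ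
            ≡⟨ collect ℓ (C * 3 ^ k) (ℓ ^ k) M ⟩
          M * Q ∎
          where
          collect : ∀ ℓ D p M → (ℓ + 1 * ℓ) * (2 * (D * p * (M + M))) + (M + M) * (ℓ * p) ≡ M * ((8 * D + 2) * (ℓ * p))
          collect = solve-∀
        Mtime≤ : M * time ≤ 31 * (n * n) * Q
        Mtime≤ = begin
          M * time          ≤⟨ *-monoʳ-≤ M (*-monoʳ-≤ R step≤) ⟩
          M * (R * (M * Q)) ≡⟨ reorder M R Q ⟩
          R * (M * M) * Q   ≤⟨ *-monoˡ-≤ Q RM²≤31n² ⟩
          31 * (n * n) * Q  ∎
          where
          reorder : ∀ M R Q → M * (R * (M * Q)) ≡ R * (M * M) * Q
          reorder = solve-∀
        regroup : ∀ n K t → n * (K * (t * (t * 1))) ≡ n * K * (t * t)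
        regroup = solve-∀
        squares : ∀ M t → M * M * (t * t) ≡ (M * t) * (M * t)
        squares = solve-∀
        final : ∀ n D Λ → (31 * (n * n) * (D * Λ)) * (31 * (n * n) * (D * Λ)) ≡
                          n * ((31 * D * Λ) * ((31 * D * Λ) * 1) * (n * (n * (n * 1))))
        final = solve-∀

-- The two reductions

singleton : ℕ → SpaceBudget
singleton m = record { n = suc m ; S = 1 ; 1≤S = ≤-refl ; S≤n = s≤s z≤n }

module Reduction (c : ℕ) (sᴱ tᴱ : ℕ → ℕ) where

  module At (β : SpaceBudget) = Parameters c sᴱ tᴱ (n β) (S β) (SpaceBudget.1≤S β) (SpaceBudget.S≤n β)

  space time : SpaceBudget → ℕ
  space β = At.space β
  time β = At.time β

  TestersIn : SpaceBudget → ℕ → Set₁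
  TestersIn β d = let m = At.M β + At.M β in
    ∃[ T ] ∃[ τ ] ∃[ ω ] τ ≤ 2 * tᴱ m × ω ≤ (S β * 2) * suc (sᴱ m) ×
      Σ (DecisionProgram m (blockDomain c m) T) λ p → SolvesElementDistinctness p ×
        Tester p (n β + n β) d (Collision (n β) d) (S β * 2) τ ω

  setCollision : ∀ β {d} → d ≤ n β ^ c + c → TestersIn β d →
                 SetCollisionIn (n β) d (space β) (time β)
  setCollision β@record { n = n ; S = suc K′ } d≤ (_ , τ , ω , τ≤ , ω≤ , p , solves , tester) =
    Algorithm.setCollisionIn e K′ g p solves (domain≤blockDomain d≤) tester
      {γ} {ℓ} {δ} {space β} (coded-Fin 1+g≤2^γ) (coded-Fin n≤2^ℓ) (coded-Fin (domain≤2^δ d≤))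
      (≤-trans (+-monoʳ-≤ ((γ + ℓ) + (suc K′ * 2) * suc ℓ) ω≤) (m≤m+n _ (suc K′ * δ)))
      (+-monoˡ-≤ (suc K′ * δ) (≤-trans (+-monoʳ-≤ (γ + ℓ) (*-monoˡ-≤ (suc ℓ) (m≤m*n (suc K′) 2))) (m≤m+n _ _)))
      n≤gM {R} enough-passes
      (*-monoʳ-≤ R (+-monoˡ-≤ (suc K′ + M) (*-monoʳ-≤ (suc e) τ≤)))
    where open At β hiding (space; time)

  space-Õ : sᴱ ∈Õ[ id ] const 1 → space ∈Õ[ n ] S
  space-Õ (C , k , n₁ , s≤) =
    11 + 2 * (C * 3 ^ k) + 2 * c , suc k , 2 + n₁ * n₁ ,
    λ β large → At.space-bound β {n₁} large C k (s≤ _ (At.n₁≤2M β large))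

  time-Õ : tᴱ ∈Õ[ id ] id → time ∈Õ√[ n ] (λ β → n β ^ 3) / S
  time-Õ (C , k , n₁ , t≤) =
    31 * (8 * (C * 3 ^ k) + 2) , suc k , 2 + n₁ * n₁ ,
    λ β large → At.time-bound β {n₁} large C k (t≤ _ (At.n₁≤2M β large))

  obliviousTesters : ∀ β {d} → (∀ m → ObliviousElementDistinctnessIn m (blockDomain c m) (sᴱ m) (tᴱ m)) →
                     TestersIn β d
  obliviousTesters β@record { S = suc K′ } solver =
    let (T , T≤ , p , bounded , oblivious , solves) = solver (At.M β + At.M β)
    in T , T , _ , ≤-trans T≤ (m≤m+n _ _) , *-monoʳ-≤ (suc K′ * 2) (n≤1+n _) , p , solves ,
       obliviousTester {ω = sᴱ (At.M β + At.M β)} (suc (K′ * 2)) p bounded oblivious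

  sequentialTesters : ∀ m {d} → (∀ m → ElementDistinctnessIn m (blockDomain c m) (sᴱ m) (tᴱ m)) →
                      TestersIn (singleton m) d
  sequentialTesters m solver =
    let M = At.M (singleton m)
        (T , T≤ , p , bounded , solves) = solver (M + M)
    in T , 2 * T , _ , *-monoʳ-≤ 2 T≤ ,
       s≤s (≤-trans (s≤s (m≤m+n _ 0)) (m≤n+m _ (sᴱ (M + M)))) , p , solves ,
       sequentialTester {ω = sᴱ (M + M)} 2 p bounded

-- The sequential case is the budget `S = 1`, which requires a positive `n`. For empty lists a
-- program without queries is correct, so 0 suffices for both bounds.
atPositive : (SpaceBudget → ℕ) → ℕ → ℕ
atPositive f zero = 0
atPositive f (suc m) = f (singleton m)

theorem4p4 : ( (∀ (d : ℕ → ℕ) → PolyBounded d →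
    ∃[ s ] ∃[ t ] s ∈Õ[ id ] const 1 × t ∈Õ[ id ] id ×
    (∀ m → ElementDistinctnessIn m (d m) (s m) (t m))) →
    (∀ (d : ℕ → ℕ) → PolyBounded d →
    ∃[ s ] ∃[ t ] s ∈Õ[ id ] const 1 × t ∈Õ√[ id ] (_^ 3) / const 1 ×
    (∀ m → SetCollisionIn m (d m) (s m) (t m))) )
    ×
    ( (∀ (d : ℕ → ℕ) → PolyBounded d →
    ∃[ s ] ∃[ t ] s ∈Õ[ id ] const 1 × t ∈Õ[ id ] id ×
    (∀ m → ObliviousElementDistinctnessIn m (d m) (s m) (t m))) →
    (∀ (d : ℕ → ℕ) → PolyBounded d →
    ∃[ s ] ∃[ t ] s ∈Õ[ n ] S × t ∈Õ√[ n ] (λ β → n β ^ 3) / S ×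
    (∀ β → SetCollisionIn (n β) (d (n β)) (s β) (t β))) )
theorem4p4 = sequential , oblivious
  where
  sequential : _
  sequential solvable d (c , d≤) with solvable (blockDomain c) (blockDomain-bounded c)
  ... | sᴱ , tᴱ , s-Õ , t-Õ , solver =
    atPositive space , atPositive time ,
    (let (C , k , n₀ , bound) = space-Õ s-Õ in
     C , k , suc n₀ , λ { (suc m) large → bound (singleton m) (<⇒≤ large) }) ,
    (let (C , k , n₀ , bound) = time-Õ t-Õ in
     C , k , suc n₀ , λ { (suc m) large → bound (singleton m) (<⇒≤ large) }) ,
    λ { zero → 0 , z≤n , last _ , ≤-refl , λ _ _ _ ()
      ; (suc m) → setCollision (singleton m) (d≤ (suc m)) (sequentialTesters m solver) }
    where open Reduction c sᴱ tᴱ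

  oblivious : _
  oblivious solvable d (c , d≤) with solvable (blockDomain c) (blockDomain-bounded c)
  ... | sᴱ , tᴱ , s-Õ , t-Õ , solver =
    space , time , space-Õ s-Õ , time-Õ t-Õ ,
    λ β → setCollision β (d≤ (n β)) (obliviousTesters β solver)
    where open Reduction c sᴱ tᴱ
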